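{- Let $d_1,d_2$ be nonzero integers, $f$ a positive integer, and $m_1,m_2,n_1,n_2\in\mathbb{Z}$; write $\vec m=(m_1,m_2)$, $\vec n=(n_1,n_2)$. The fine Kloosterman sum $\mathscr{S}_{w_0}(\vec m,\vec n;d_1,d_2,f)$ is zero unless $\gcd(m_2d_2,f)=\gcd(n_2d_1,f)$. If this condition holds, then \[ \mathscr{S}_{w_0}(\vec m,\vec n;d_1,d_2,f)= f\sum_{\substack{x_3,y_3 \bmod f\\ x_3y_3\equiv 1 \ (\mathrm{mod}\ f)\\ m_2d_2+n_2d_1y_3\equiv 0\ (\mathrm{mod}\ f)}} S\!\left(n_1,\tfrac{m_2d_2+n_2d_1y_3}{f};d_1\right)\, S\!\left(m_1,\tfrac{n_2d_1+m_2d_2x_3}{f};d_2\right), \] where the sum runs over pairs of residue classes $x_3,y_3$ modulo $f$ (with any integer representatives).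
   Context: Notation: $e(z)=e^{2\pi i z}$. $U_3(R)$ denotes the group of $3\times 3$ upper triangular unipotent matrices with entries in $R$, and $\Gamma_\infty=U_3(\mathbb{Z})$. Let $w_0=\begin{pmatrix}0&0&1\\0&-1&0\\1&0&0\end{pmatrix}$ and for nonzero reals $c_1,c_2$ let $t(c_1,c_2)=\mathrm{diag}(c_1,c_2/c_1,1/c_2)$. Every $A\in \mathrm{SL}_3(\mathbb{R})$ with $A_{31}\neq 0$ and $A_{21}A_{32}-A_{22}A_{31}\neq 0$ has a unique decomposition $A=u_L(A)\,w_0\,t\,u_R(A)$ with $u_L(A),u_R(A)\in U_3(\mathbb{R})$ and $t$ diagonal; then $t=t(A_{31},A_{21}A_{32}-A_{22}A_{31})$. For $\vec n=(n_1,n_2)\in\mathbb{Z}^2$ and $u=(u_{ij})\in U_3(\mathbb{R})$ put $\psi_{\vec n}(u)=e(n_1u_{12}+n_2u_{23})$. For nonzero integers $d_1,d_2$ and a positive integer $f$, the fine Kloosterman set is $\Omega(d_1,d_2,f)=\{A\in \mathrm{SL}_3(\mathbb{Z}):\ \gcd(A_{31},A_{32})=f,\ A_{31}=d_1f,\ A_{21}A_{32}-A_{22}A_{31}=d_2f\}$; it is invariant under left and right multiplication by $\Gamma_\infty$. The fine Kloosterman sum is $\mathscr{S}_{w_0}(\vec m,\vec n;d_1,d_2,f)=\sum_{A\in\Gamma_\infty\backslash\Omega(d_1,d_2,f)/\Gamma_\infty}\psi_{\vec m}(u_L(A))\psi_{\vec n}(u_R(A))$. The classical Kloosterman sum is $S(m,n;c)=\sum_{a,d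 \bmod c,\ ad\equiv 1 \bmod c} e\big(\frac{ma+nd}{c}\big)$ for a nonzero integer $c$. -}

module Defs where

open import Level using (_⊔_)
open import Data.Nat as ℕ using (ℕ; zero; suc; NonZero)
open import Data.Nat.Divisibility as ℕD using (_∣?_)
open import Data.Nat.GCD using (gcd)
open import Data.Integer as ℤ using (ℤ; +_; -[1+_]; ∣_∣; _/ℕ_)
open import Data.Rational as ℚ using (ℚ)
open import Data.Fin using (Fin)
open import Data.Product using (Σ; ∃; _×_; _,_)
open import Data.Sum using (_⊎_)
open import Relation.Nullary using (¬_; yes; no)
open import Relation.Binary.PropositionalEquality using (_≡_)
open import Algebra.Bundles using (CommutativeRing)

record Mat3 : Set where
  constructor mat3
  field
    a11 a12 a13 a21 a22 a23 a31 a32 a33 : ℤ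
open Mat3 public

infixl 7 _⊗_
_⊗_ : Mat3 → Mat3 → Mat3
A ⊗ B = mat3
  (r1 a11 a12 a13 (a11 B) (a21 B) (a31 B)) (r1 a11 a12 a13 (a12 B) (a22 B) (a32 B)) (r1 a11 a12 a13 (a13 B) (a23 B) (a33 B))
  (r1 a21 a22 a23 (a11 B) (a21 B) (a31 B)) (r1 a21 a22 a23 (a12 B) (a22 B) (a32 B)) (r1 a21 a22 a23 (a13 B) (a23 B) (a33 B))
  (r1 a31 a32 a33 (a11 B) (a21 B) (a31 B)) (r1 a31 a32 a33 (a12 B) (a22 B) (a32 B)) (r1 a31 a32 a33 (a13 B) (a23 B) (a33 B))
  where
  r1 : (Mat3 → ℤ) → (Mat3 → ℤ) → (Mat3 → ℤ) → ℤ → ℤ → ℤ → ℤ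
  r1 x y z p q r = x A ℤ.* p ℤ.+ y A ℤ.* q ℤ.+ z A ℤ.* r

det3 : Mat3 → ℤ
det3 A =
    a11 A ℤ.* (a22 A ℤ.* a33 A ℤ.- a23 A ℤ.* a32 A)
  ℤ.- a12 A ℤ.* (a21 A ℤ.* a33 A ℤ.- a23 A ℤ.* a31 A)
  ℤ.+ a13 A ℤ.* (a21 A ℤ.* a32 A ℤ.- a22 A ℤ.* a31 A)

InSL3 : Mat3 → Set
InSL3 A = det3 A ≡ ℤ.1ℤ

unip : ℤ → ℤ → ℤ → Mat3
unip x y z = mat3 ℤ.1ℤ x y ℤ.0ℤ ℤ.1ℤ z ℤ.0ℤ ℤ.0ℤ ℤ.1ℤ

SameDoubleCoset : Mat3 → Mat3 → Set
SameDoubleCoset A B =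
  Σ ℤ λ x → Σ ℤ λ y → Σ ℤ λ z → Σ ℤ λ x' → Σ ℤ λ y' → Σ ℤ λ z' →
    B ≡ unip x y z ⊗ A ⊗ unip x' y' z'

minor2 : Mat3 → ℤ
minor2 A = a21 A ℤ.* a32 A ℤ.- a22 A ℤ.* a31 A

InΩ : ℤ → ℤ → ℕ → Mat3 → Set
InΩ d₁ d₂ f A =
  InSL3 A × gcd ∣ a31 A ∣ ∣ a32 A ∣ ≡ f
  × a31 A ≡ d₁ ℤ.* + f × minor2 A ≡ d₂ ℤ.* + f

IsDoubleCosetReps : ℤ → ℤ → ℕ → (k : ℕ) → (Fin k → Mat3) → Set
IsDoubleCosetReps d₁ d₂ f k reps =
  ((i : Fin k) → InΩ d₁ d₂ f (reps i)) ×
  ((A : Mat3) → InΩ d₁ d₂ f A →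
     Σ (Fin k) λ i → SameDoubleCoset (reps i) A ×
       ((j : Fin k) → SameDoubleCoset (reps j) A → j ≡ i))

-- p / q as a rational (q ≠ 0; junk value 0 when q = 0)
frac : ℤ → ℤ → ℚ
frac p (+ zero)    = ℚ.0ℚ
frac p (+ (suc n)) = p ℚ./ suc n
frac p -[1+ n ]    = ℤ.- p ℚ./ suc n

ℤ→ℚ : ℤ → ℚ
ℤ→ℚ z = z ℚ./ 1

-- upper triangular unipotent matrices over ℚ, [[1,u12,u13],[0,1,u23],[0,0,1]]
record U3Q : Set where
  constructor u3q
  field
    u12 u13 u23 : ℚ
open U3Q public

-- For A = u_L w₀ t(A₃₁, A₂₁A₃₂−A₂₂A₃₁) u_R, solving the entries gives:
uL : Mat3 → U3Q
uL A = u3q (frac (a11 A ℤ.* a32 A ℤ.- a12 A ℤ.* a31 A) (minor2 A))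
           (frac (a11 A) (a31 A))
           (frac (a21 A) (a31 A))

uR : Mat3 → U3Q
uR A = u3q (frac (a32 A) (a31 A))
           (frac (a33 A) (a31 A))
           (frac (a21 A ℤ.* a33 A ℤ.- a23 A ℤ.* a31 A) (minor2 A))

Divides : ℕ → ℤ → Set
Divides q z = q ℕD.∣ ∣ z ∣

module _ {c ℓ} (R : CommutativeRing c ℓ) where
  open CommutativeRing R

  IsDomain : Set (c ⊔ ℓ)
  IsDomain = ∀ x y → x * y ≈ 0# → x ≈ 0# ⊎ y ≈ 0#

  IsStdChar : (ℚ → Carrier) → Set ℓ
  IsStdChar e =
    (∀ r s → e (r ℚ.+ s) ≈ e r * e s) ×
    (∀ r → e r ≈ 1# → ∃ λ (z : ℤ) → r ≡ ℤ→ℚ z) ×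
    (∀ (z : ℤ) → e (ℤ→ℚ z) ≈ 1#)

module WithChar {c ℓ} (R : CommutativeRing c ℓ) (e : ℚ → CommutativeRing.Carrier R) where
  open CommutativeRing R

  sumR : ℕ → (ℕ → Carrier) → Carrier
  sumR zero    g = 0#
  sumR (suc n) g = sumR n g + g n

  sumFin : (k : ℕ) → (Fin k → Carrier) → Carrier
  sumFin zero    g = 0#
  sumFin (suc k) g = g Data.Fin.zero + sumFin k (λ i → g (Data.Fin.suc i))

  natR : ℕ → Carrier
  natR zero    = 0#
  natR (suc n) = 1# + natR n

  ψ : ℤ → ℤ → U3Q → Carrier
  ψ n₁ n₂ u = e (ℤ→ℚ n₁ ℚ.* u12 u ℚ.+ ℤ→ℚ n₂ ℚ.* u23 u)

  Kl : ℤ → ℤ → ℤ → Carrier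
  Kl m n c =
    sumR ∣ c ∣ λ a → sumR ∣ c ∣ λ d →
      case? (∣ c ∣ ∣? ∣ + a ℤ.* + d ℤ.- ℤ.1ℤ ∣)
        (e (frac (m ℤ.* + a ℤ.+ n ℤ.* + d) c))
    where
    case? : ∀ {P : Set} → Relation.Nullary.Dec P → Carrier → Carrier
    case? (yes _) x = x
    case? (no _)  _ = 0#

  FineKl : ℤ → ℤ → ℤ → ℤ → (k : ℕ) → (Fin k → Mat3) → Carrier
  FineKl m₁ m₂ n₁ n₂ k reps =
    sumFin k λ i → ψ m₁ m₂ (uL (reps i)) * ψ n₁ n₂ (uR (reps i))

  RHS : ℤ → ℤ → ℤ → ℤ → ℤ → ℤ → (f : ℕ) → .{{NonZero f}} → Carrier
  RHS m₁ m₂ n₁ n₂ d₁ d₂ f =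
    natR f * (sumR f λ x₃ → sumR f λ y₃ →
      case? (f ∣? ∣ + x₃ ℤ.* + y₃ ℤ.- ℤ.1ℤ ∣)
        (case? (f ∣? ∣ m₂ ℤ.* d₂ ℤ.+ n₂ ℤ.* d₁ ℤ.* + y₃ ∣)
          (Kl n₁ ((m₂ ℤ.* d₂ ℤ.+ n₂ ℤ.* d₁ ℤ.* + y₃) /ℕ f) d₁
           * Kl m₁ ((n₂ ℤ.* d₁ ℤ.+ m₂ ℤ.* d₂ ℤ.* + x₃) /ℕ f) d₂)))
    where
    case? : ∀ {P : Set} → Relation.Nullary.Dec P → Carrier → Carrier
    case? (yes _) x = x
    case? (no _)  _ = 0#

{-# OPTIONS --safe #-}
module Submission where

-- A fine Kloosterman set is parametrised by the reduced word of w₀: every double coset contains exactly one product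
--   [[r,t],[d₂,S]]⊕1 · 1⊕[[x,k],[f,y]] · [[p,q],[d₁,b]]⊕1
-- of embedded SL₂(ℤ)-matrices with b mod d₁, y mod f and S mod d₂f, where S is a unit modulo d₂ only.
-- Completeness and uniqueness are seen on Plücker coordinates: modulo Γ∞ on the left, a matrix is determined by its
-- bottom row and its bottom 2×2 minors.  On this product the phase is
--   [n₁b + pX/f]/d₁ + [m₁r + SX′/f]/d₂   with X = m₂d₂ + n₂d₁y and X′ = n₂d₁ + m₂d₂x,
-- so writing S = s + d₂j and summing over j mod f gives f if f ∣ X′, and 0 otherwise; f ∣ X′ is equivalent to f ∣ X
-- since xy ≡ 1 mod f, and it forces gcd(m₂d₂, f) = gcd(n₂d₁, f).

open import Defs
open import Level using (Level)
open import Data.Bool using (if_then_else_)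
open import Data.Nat as ℕ using (ℕ; zero; suc; NonZero)
import Data.Nat.Properties as ℕₚ
import Data.Nat.Divisibility as ℕD
open import Data.Nat.GCD using (gcd; gcd-GCD; gcd-greatest; gcd[m,n]∣m; gcd[m,n]∣n; c*gcd[m,n]≡gcd[cm,cn]; module Bézout)
open import Data.Integer as ℤ using (ℤ; +_; -[1+_]; ∣_∣; _+_; _*_; _-_; -_; 0ℤ; 1ℤ; _/_; _%_; _/ℕ_; _%ℕ_; ≢-nonZero)
import Data.Integer.Properties as ℤₚ
open import Data.Integer.DivMod using (n%d<d; a≡a%n+[a/n]*n; n%ℕd<d; a≡a%ℕn+[a/ℕn]*n)
open import Data.Integer.Divisibility.Signed using (divides; ∣ᵤ⇒∣; ∣⇒∣ᵤ; m∣∣m∣; ∣-trans; ∣m∣n⇒∣m-n; ∣m⇒∣m*n; ∣n⇒∣m*n) renaming (_∣_ to _∣ℤ_; _∣?_ to _∣ℤ?_)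
open import Data.Integer.Tactic.RingSolver using (solve; solve-∀)
open import Data.Rational as ℚ using (ℚ)
import Data.Rational.Properties as ℚₚ
open import Data.Rational.Unnormalised as ℚᵘ using (mkℚᵘ; *≡*)
import Data.Rational.Unnormalised.Properties as ℚᵘₚ
open import Data.Fin using (Fin)
open import Data.List using (List; []; _∷_; _++_; foldr; map; filter; cartesianProduct; downFrom; tabulate; allFin)
import Data.List.Properties as Listₚ
open import Data.List.Membership.Propositional using (_∈_)
open import Data.List.Membership.Propositional.Properties using (∈-cartesianProduct⁺; ∈-cartesianProduct⁻; ∈-filter⁺; ∈-filter⁻; ∈-downFrom⁺; ∈-downFrom⁻; ∈-map⁺; ∈-map⁻; ∈-allFin)
open import Data.List.Membership.Propositional.Properties.WithK using (unique∧set⇒bag)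
open import Data.List.Relation.Unary.Any using (here; there)
open import Data.List.Relation.Unary.Unique.Propositional using (Unique)
import Data.List.Relation.Unary.Unique.Propositional.Properties as Unique
open import Data.List.Relation.Binary.BagAndSetEquality using (∼bag⇒↭)
open import Data.List.Relation.Binary.Permutation.Propositional using (_↭_; ↭⇒↭ₛ′)
open import Data.List.Relation.Binary.Permutation.Propositional.Properties using (map⁺)
import Data.List.Relation.Binary.Permutation.Setoid.Properties as Permutationₛ
open import Data.Product using (Σ; ∃; ∃₂; _×_; _,_; proj₁; proj₂)
open import Data.Sum using (_⊎_; inj₁; inj₂)
open import Function using (mk⇔)
open import Relation.Nullary using (¬_; Dec; yes; no; does; contradiction)
open import Relation.Nullary.Decidable using (dec-true; dec-false)
open import Relation.Unary using (Pred; Decidable)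
open import Relation.Binary.PropositionalEquality using (_≡_; _≢_; refl; sym; trans; cong; cong₂; subst; module ≡-Reasoning)
open import Algebra.Bundles using (CommutativeRing)
import Algebra.Properties.CommutativeSemigroup as CommutativeSemigroupProperties
import Algebra.Properties.Ring as RingProperties
import Algebra.Solver.CommutativeMonoid as CommutativeMonoidSolver

-- The factor `f` comes from a stabiliser. Right multiplication by `unip x′ y′ z′` adds
-- `y′ a31 + z′ a32` to `a33` and `z′ minor2` to `m13`. With `a31 = d₁f` and `a32 = Bf`, the pairs
-- `(y′, z′) = l (B, - d₁)` leave `a33` alone but move `m13` by `- l d₁d₂f`. So once the bottom row
-- is reduced, `S` is determined modulo `d₂f` and no finer, which leaves `f` lifts `j` over each
-- unit `s` modulo `d₂`. The index of a matrix is a relation, `HasIndex`, rather than a function: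
-- existence and uniqueness are proved separately, from Bézout relations with explicit multipliers.
-- Arbitrary representatives are then matched with the list of all indices by a permutation. The
-- vanishing statement is read off the right-hand side, whose sum is empty when the two gcds differ.

-- Ring identities modulo hypotheses: x ≡ y is checked by the ring solver after adding multiples of l - r.
lin₁ : ∀ {x y l r : ℤ} k → l ≡ r → x ≡ y + k * (l - r) → x ≡ y
lin₁ {y = y} {l} k refl x≡ rewrite ℤₚ.+-inverseʳ l | ℤₚ.*-zeroʳ k = trans x≡ (ℤₚ.+-identityʳ y)

lin₂ : ∀ {x y l r l′ r′ : ℤ} k → l ≡ r → ∀ k′ → l′ ≡ r′ →
       x ≡ y + k * (l - r) + k′ * (l′ - r′) → x ≡ y
lin₂ k h k′ h′ x≡ = lin₁ k h (lin₁ k′ h′ x≡)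

lin₃ : ∀ {x y l r l′ r′ l″ r″ : ℤ} k → l ≡ r → ∀ k′ → l′ ≡ r′ → ∀ k″ → l″ ≡ r″ →
       x ≡ y + k * (l - r) + k′ * (l′ - r′) + k″ * (l″ - r″) → x ≡ y
lin₃ k h k′ h′ k″ h″ x≡ = lin₂ k h k′ h′ (lin₁ k″ h″ x≡)

-- Minors, unipotent row and column operations, Plücker coordinates.

-- m13 and m23 are, like minor2, minors of rows 2 and 3; N12 is the minor of rows 1 and 3 in columns 1 and 2.
m13 m23 N12 : Mat3 → ℤ
m13 A = a21 A * a33 A - a23 A * a31 A
m23 A = a22 A * a33 A - a23 A * a32 A
N12 A = a11 A * a32 A - a12 A * a31 A

-- The products by `unip` with the zeros and ones already removed, so that the changes of the bottom
-- row and of `a21` hold by `refl`.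
rowOp colOp : ℤ → ℤ → ℤ → Mat3 → Mat3
rowOp x y z A = mat3
  (a11 A + x * a21 A + y * a31 A) (a12 A + x * a22 A + y * a32 A) (a13 A + x * a23 A + y * a33 A)
  (a21 A + z * a31 A) (a22 A + z * a32 A) (a23 A + z * a33 A)
  (a31 A) (a32 A) (a33 A)
colOp x y z A = mat3
  (a11 A) (a12 A + x * a11 A) (a13 A + y * a11 A + z * a12 A)
  (a21 A) (a22 A + x * a21 A) (a23 A + y * a21 A + z * a22 A)
  (a31 A) (a32 A + x * a31 A) (a33 A + y * a31 A + z * a32 A)

mat3-cong : ∀ {a b c d e f g h i a′ b′ c′ d′ e′ f′ g′ h′ i′} →
  a ≡ a′ → b ≡ b′ → c ≡ c′ → d ≡ d′ → e ≡ e′ → f ≡ f′ → g ≡ g′ → h ≡ h′ → i ≡ i′ →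
  mat3 a b c d e f g h i ≡ mat3 a′ b′ c′ d′ e′ f′ g′ h′ i′
mat3-cong refl refl refl refl refl refl refl refl refl = refl

⊗-unip : ∀ x y z x′ y′ z′ A →
  unip x y z ⊗ A ⊗ unip x′ y′ z′ ≡ rowOp x y z (colOp x′ y′ z′ A)
⊗-unip x y z x′ y′ z′ (mat3 a b c d e f g h i) =
  mat3-cong (r₁c₁ a d g b e h c f i) (r₁c₂ a d g b e h c f i) (r₁c₃ a d g b e h c f i)
            (r₂c₁ a d g b e h c f i) (r₂c₂ a d g b e h c f i) (r₂c₃ a d g b e h c f i)
            (r₃c₁ a d g b e h c f i) (r₃c₂ a d g b e h c f i) (r₃c₃ a d g b e h c f i)
  where
  module _ (a d g b e h c f i : ℤ) where
    r₁c₁ : (1ℤ * a + x * d + y * g) * 1ℤ + (1ℤ * b + x * e + y * h) * 0ℤ + (1ℤ * c + x * f + y * i) * 0ℤ ≡ a + x * d + y * g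
    r₁c₁ = solve (a ∷ d ∷ g ∷ b ∷ e ∷ h ∷ c ∷ f ∷ i ∷ x ∷ y ∷ [])
    r₁c₂ : (1ℤ * a + x * d + y * g) * x′ + (1ℤ * b + x * e + y * h) * 1ℤ + (1ℤ * c + x * f + y * i) * 0ℤ ≡ b + x′ * a + x * (e + x′ * d) + y * (h + x′ * g)
    r₁c₂ = solve (a ∷ d ∷ g ∷ b ∷ e ∷ h ∷ c ∷ f ∷ i ∷ x ∷ y ∷ x′ ∷ [])
    r₁c₃ : (1ℤ * a + x * d + y * g) * y′ + (1ℤ * b + x * e + y * h) * z′ + (1ℤ * c + x * f + y * i) * 1ℤ ≡ c + y′ * a + z′ * b + x * (f + y′ * d + z′ * e) + y * (i + y′ * g + z′ * h)
    r₁c₃ = solve (a ∷ d ∷ g ∷ b ∷ e ∷ h ∷ c ∷ f ∷ i ∷ x ∷ y ∷ y′ ∷ z′ ∷ [])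
    r₂c₁ : (0ℤ * a + 1ℤ * d + z * g) * 1ℤ + (0ℤ * b + 1ℤ * e + z * h) * 0ℤ + (0ℤ * c + 1ℤ * f + z * i) * 0ℤ ≡ d + z * g
    r₂c₁ = solve (a ∷ d ∷ g ∷ b ∷ e ∷ h ∷ c ∷ f ∷ i ∷ z ∷ [])
    r₂c₂ : (0ℤ * a + 1ℤ * d + z * g) * x′ + (0ℤ * b + 1ℤ * e + z * h) * 1ℤ + (0ℤ * c + 1ℤ * f + z * i) * 0ℤ ≡ e + x′ * d + z * (h + x′ * g)
    r₂c₂ = solve (a ∷ d ∷ g ∷ b ∷ e ∷ h ∷ c ∷ f ∷ i ∷ z ∷ x′ ∷ [])
    r₂c₃ : (0ℤ * a + 1ℤ * d + z * g) * y′ + (0ℤ * b + 1ℤ * e + z * h) * z′ + (0ℤ * c + 1ℤ * f + z * i) * 1ℤ ≡ f + y′ * d + z′ * e + z * (i + y′ * g + z′ * h)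
    r₂c₃ = solve (a ∷ d ∷ g ∷ b ∷ e ∷ h ∷ c ∷ f ∷ i ∷ z ∷ y′ ∷ z′ ∷ [])
    r₃c₁ : (0ℤ * a + 0ℤ * d + 1ℤ * g) * 1ℤ + (0ℤ * b + 0ℤ * e + 1ℤ * h) * 0ℤ + (0ℤ * c + 0ℤ * f + 1ℤ * i) * 0ℤ ≡ g
    r₃c₁ = solve (a ∷ d ∷ g ∷ b ∷ e ∷ h ∷ c ∷ f ∷ i ∷ [])
    r₃c₂ : (0ℤ * a + 0ℤ * d + 1ℤ * g) * x′ + (0ℤ * b + 0ℤ * e + 1ℤ * h) * 1ℤ + (0ℤ * c + 0ℤ * f + 1ℤ * i) * 0ℤ ≡ h + x′ * g
    r₃c₂ = solve (a ∷ d ∷ g ∷ b ∷ e ∷ h ∷ c ∷ f ∷ i ∷ x′ ∷ [])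
    r₃c₃ : (0ℤ * a + 0ℤ * d + 1ℤ * g) * y′ + (0ℤ * b + 0ℤ * e + 1ℤ * h) * z′ + (0ℤ * c + 0ℤ * f + 1ℤ * i) * 1ℤ ≡ i + y′ * g + z′ * h
    r₃c₃ = solve (a ∷ d ∷ g ∷ b ∷ e ∷ h ∷ c ∷ f ∷ i ∷ y′ ∷ z′ ∷ [])

minor-rowOp : ∀ z a b c d → (a + z * c) * d - (b + z * d) * c ≡ a * d - b * c
minor-rowOp = solve-∀

N12-rowOp : ∀ x y z A → N12 (rowOp x y z A) ≡ N12 A + x * minor2 A
N12-rowOp x y z (mat3 a b c d e f g h i) = lemma x y a b d e g h
  where
  lemma : ∀ x y a b d e g h → (a + x * d + y * g) * h - (b + x * e + y * h) * g ≡ a * h - b * g + x * (d * h - e * g)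
  lemma = solve-∀

minor2-colOp : ∀ x y z A → minor2 (colOp x y z A) ≡ minor2 A
minor2-colOp x y z (mat3 a b c d e f g h i) = lemma x d e g h
  where
  lemma : ∀ x d e g h → d * (h + x * g) - (e + x * d) * g ≡ d * h - e * g
  lemma = solve-∀

N12-colOp : ∀ x y z A → N12 (colOp x y z A) ≡ N12 A
N12-colOp x y z (mat3 a b c d e f g h i) = lemma x a b g h
  where
  lemma : ∀ x d e g h → d * (h + x * g) - (e + x * d) * g ≡ d * h - e * g
  lemma = solve-∀

m13-colOp : ∀ x y z A → m13 (colOp x y z A) ≡ m13 A + z * minor2 A
m13-colOp x y z (mat3 a b c d e f g h i) = lemma y z d e f g h i
  where
  lemma : ∀ y z d e f g h i → d * (i + y * g + z * h) - (f + y * d + z * e) * g ≡ d * i - f * g + z * (d * h - e * g)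
  lemma = solve-∀

det3-colOp : ∀ x y z A → det3 (colOp x y z A) ≡ det3 A
det3-colOp x y z (mat3 a b c d e f g h i) = lemma x y z a b c d e f g h i
  where
  lemma : ∀ x y z a b c d e f g h i →
      a * ((e + x * d) * (i + y * g + z * h) - (f + y * d + z * e) * (h + x * g))
    - (b + x * a) * (d * (i + y * g + z * h) - (f + y * d + z * e) * g)
    + (c + y * a + z * b) * (d * (h + x * g) - (e + x * d) * g)
    ≡ a * (e * i - f * h) - b * (d * i - f * g) + c * (d * h - e * g)
  lemma = solve-∀

-- A determinant with rows 3, 2, 3 vanishes; this is its expansion along the first copy of row 3.
plücker : ∀ A → a31 A * m23 A ≡ a32 A * m13 A - a33 A * minor2 A
plücker (mat3 a b c d e f g h i) = lemma d e f g h i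
  where
  lemma : ∀ d e f g h i → g * (e * i - f * h) ≡ h * (d * i - f * g) - i * (d * h - e * g)
  lemma = solve-∀

-- Cramer's rule for rows, multiplied through by the determinant so that it holds over the integers:
-- each coefficient is the determinant with `(u, v, w)` in place of one row.
cramer : ∀ a b c d e f g h i u v w →
  let D  = det3 (mat3 a b c d e f g h i)
      D₁ = det3 (mat3 u v w d e f g h i)
      D₂ = det3 (mat3 a b c u v w g h i)
      D₃ = det3 (mat3 a b c d e f u v w)
  in u * D ≡ D₁ * a + D₂ * d + D₃ * g × v * D ≡ D₁ * b + D₂ * e + D₃ * h × w * D ≡ D₁ * c + D₂ * f + D₃ * i
cramer a b c d e f g h i u v w =
  column₁ u v w a b c d e f g h i , column₂ u v w a b c d e f g h i , column₃ u v w a b c d e f g h i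
  where
  column₁ : ∀ u v w a b c d e f g h i →
    u * (a * (e * i - f * h) - b * (d * i - f * g) + c * (d * h - e * g)) ≡
      (u * (e * i - f * h) - v * (d * i - f * g) + w * (d * h - e * g)) * a
    + (a * (v * i - w * h) - b * (u * i - w * g) + c * (u * h - v * g)) * d
    + (a * (e * w - f * v) - b * (d * w - f * u) + c * (d * v - e * u)) * g
  column₁ = solve-∀
  column₂ : ∀ u v w a b c d e f g h i →
    v * (a * (e * i - f * h) - b * (d * i - f * g) + c * (d * h - e * g)) ≡
      (u * (e * i - f * h) - v * (d * i - f * g) + w * (d * h - e * g)) * b
    + (a * (v * i - w * h) - b * (u * i - w * g) + c * (u * h - v * g)) * e
    + (a * (e * w - f * v) - b * (d * w - f * u) + c * (d * v - e * u)) * h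
  column₂ = solve-∀
  column₃ : ∀ u v w a b c d e f g h i →
    w * (a * (e * i - f * h) - b * (d * i - f * g) + c * (d * h - e * g)) ≡
      (u * (e * i - f * h) - v * (d * i - f * g) + w * (d * h - e * g)) * c
    + (a * (v * i - w * h) - b * (u * i - w * g) + c * (u * h - v * g)) * f
    + (a * (e * w - f * v) - b * (d * w - f * u) + c * (d * v - e * u)) * i
  column₃ = solve-∀

-- Expand the rows of `B` over those of `C` by Cramer's rule. Since the bottom data agree, the first
-- row of `B` has coefficient `det3 B = 1` at the first row of `C`; the second row of `B` has a
-- determinant with a repeated row, hence 0, at the first row and `det3 C = 1` at the second. What
-- remains is a unipotent row operation.
same-minors⇒rowOp : ∀ B C → InSL3 B → InSL3 C →
  a31 B ≡ a31 C → a32 B ≡ a32 C → a33 B ≡ a33 C →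
  minor2 B ≡ minor2 C → m13 B ≡ m13 C → m23 B ≡ m23 C →
  Σ ℤ λ x → Σ ℤ λ y → Σ ℤ λ z → B ≡ rowOp x y z C
same-minors⇒rowOp (mat3 p q r u v w g h i) (mat3 a b c d e f .g .h .i) detB detC refl refl refl e₁₂ e₁₃ e₂₃ =
  D₂ p q r , D₃ p q r , D₃ u v w ,
  mat3-cong (row₁ p (proj₁ C₁)) (row₁ q (proj₁ (proj₂ C₁))) (row₁ r (proj₂ (proj₂ C₁)))
            (row₂ u (proj₁ C₂)) (row₂ v (proj₁ (proj₂ C₂))) (row₂ w (proj₂ (proj₂ C₂)))
            refl refl refl
  where
  D₁ D₂ D₃ : ℤ → ℤ → ℤ → ℤ
  D₁ u v w = det3 (mat3 u v w d e f g h i)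
  D₂ u v w = det3 (mat3 a b c u v w g h i)
  D₃ u v w = det3 (mat3 a b c d e f u v w)
  C₁ = cramer a b c d e f g h i p q r
  C₂ = cramer a b c d e f g h i u v w
  expand : ∀ s t k → s * (v * i - w * h) - t * (u * i - w * g) + k * (u * h - v * g) ≡
                     s * (e * i - f * h) - t * (d * i - f * g) + k * (d * h - e * g)
  expand s t k = cong₂ _+_ (cong₂ _-_ (cong (s *_) e₂₃) (cong (t *_) e₁₃)) (cong (k *_) e₁₂)
  repeated : ∀ u v w g h i → u * (v * i - w * h) - v * (u * i - w * g) + w * (u * h - v * g) ≡ 0ℤ
  repeated = solve-∀
  D : ℤ
  D = det3 (mat3 a b c d e f g h i)
  row₁ : ∀ t {α δ γ} → t * D ≡ D₁ p q r * α + D₂ p q r * δ + D₃ p q r * γ → t ≡ α + D₂ p q r * δ + D₃ p q r * γ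
  row₁ t {α} {δ} {γ} eq = begin
    t                                               ≡⟨ ℤₚ.*-identityʳ t ⟨
    t * 1ℤ                                          ≡⟨ cong (t *_) detC ⟨
    t * D                                           ≡⟨ eq ⟩
    D₁ p q r * α + D₂ p q r * δ + D₃ p q r * γ      ≡⟨ cong (λ k → k * α + D₂ p q r * δ + D₃ p q r * γ) (trans (sym (expand p q r)) detB) ⟩
    1ℤ * α + D₂ p q r * δ + D₃ p q r * γ            ≡⟨ cong (λ k → k + D₂ p q r * δ + D₃ p q r * γ) (ℤₚ.*-identityˡ α) ⟩
    α + D₂ p q r * δ + D₃ p q r * γ                 ∎
    where open ≡-Reasoning
  row₂ : ∀ t {α δ γ} → t * D ≡ D₁ u v w * α + D₂ u v w * δ + D₃ u v w * γ → t ≡ δ + D₃ u v w * γ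
  row₂ t {α} {δ} {γ} eq = begin
    t                                               ≡⟨ ℤₚ.*-identityʳ t ⟨
    t * 1ℤ                                          ≡⟨ cong (t *_) detC ⟨
    t * D                                           ≡⟨ eq ⟩
    D₁ u v w * α + D₂ u v w * δ + D₃ u v w * γ      ≡⟨ cong₂ (λ k l → k * α + l * δ + D₃ u v w * γ) (trans (sym (expand u v w)) (repeated u v w g h i)) (trans (expand a b c) detC) ⟩
    0ℤ * α + 1ℤ * δ + D₃ u v w * γ                  ≡⟨ cong (_+ D₃ u v w * γ) (trans (cong₂ _+_ (ℤₚ.*-zeroˡ α) (ℤₚ.*-identityˡ δ)) (ℤₚ.+-identityˡ δ)) ⟩
    δ + D₃ u v w * γ                                ∎
    where open ≡-Reasoning

-- The Plücker relation, divided by the nonzero `a31`, recovers `m23` from the other five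
-- coordinates; after the column operation all Plücker coordinates agree.
sameDoubleCoset : ∀ A B x y z → InSL3 A → InSL3 B → .{{ℤ.NonZero (a31 A)}} →
  a31 B ≡ a31 A → a32 B ≡ a32 A + x * a31 A → a33 B ≡ a33 A + y * a31 A + z * a32 A →
  minor2 B ≡ minor2 A → m13 B ≡ m13 A + z * minor2 A → SameDoubleCoset A B
sameDoubleCoset A B x y z detA detB e₃₁ e₃₂ e₃₃ e₁₂ e₁₃ =
  let C = colOp x y z A
      f₁₂ = trans e₁₂ (sym (minor2-colOp x y z A))
      f₁₃ = trans e₁₃ (sym (m13-colOp x y z A))
      f₂₃ = ℤₚ.*-cancelˡ-≡ (a31 A) (m23 B) (m23 C) (begin
        a31 A * m23 B                     ≡⟨ cong (_* m23 B) e₃₁ ⟨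
        a31 B * m23 B                     ≡⟨ plücker B ⟩
        a32 B * m13 B - a33 B * minor2 B  ≡⟨ cong₂ _-_ (cong₂ _*_ e₃₂ f₁₃) (cong₂ _*_ e₃₃ f₁₂) ⟩
        a32 C * m13 C - a33 C * minor2 C  ≡⟨ plücker C ⟨
        a31 A * m23 C                     ∎)
      x′ , y′ , z′ , eq = same-minors⇒rowOp B C detB (trans (det3-colOp x y z A) detA) e₃₁ e₃₂ e₃₃ f₁₂ f₁₃ f₂₃
  in x′ , y′ , z′ , x , y , z , trans eq (sym (⊗-unip x′ y′ z′ x y z A))
  where open ≡-Reasoning

-- `N12`, `a21`, `a32` and `m13` are numerators of the four fractions in the phase, and each changes
-- by a multiple of its denominator. The same `z` governs `a33` and `m13`, which ties the residue
-- `y` to `S`.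
record CosetInvariants (A B : Mat3) : Set where
  field
    {v w x y z} : ℤ
    N12≡    : N12 B ≡ N12 A + v * minor2 A
    a21≡    : a21 B ≡ a21 A + w * a31 A
    a31≡    : a31 B ≡ a31 A
    a32≡    : a32 B ≡ a32 A + x * a31 A
    a33≡    : a33 B ≡ a33 A + y * a31 A + z * a32 A
    minor2≡ : minor2 B ≡ minor2 A
    m13≡    : m13 B ≡ m13 A + z * minor2 A

rowOp-colOp-invariants : ∀ v u w x y z A → CosetInvariants A (rowOp v u w (colOp x y z A))
rowOp-colOp-invariants v u w x y z A = record
  { v = v ; w = w ; x = x ; y = y ; z = z
  ; N12≡    = trans (N12-rowOp v u w C) (cong₂ (λ k l → k + v * l) (N12-colOp x y z A) (minor2-colOp x y z A))
  ; a21≡    = refl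
  ; a31≡    = refl
  ; a32≡    = refl
  ; a33≡    = refl
  ; minor2≡ = trans (minor-rowOp w (a21 C) (a22 C) (a31 C) (a32 C)) (minor2-colOp x y z A)
  ; m13≡    = trans (minor-rowOp w (a21 C) (a23 C) (a31 C) (a33 C)) (m13-colOp x y z A)
  }
  where C = colOp x y z A

sameDoubleCoset⁻¹ : ∀ A B → SameDoubleCoset A B → CosetInvariants A B
sameDoubleCoset⁻¹ A B (v , u , w , x , y , z , B≡) =
  subst (CosetInvariants A) (sym (trans B≡ (⊗-unip v u w x y z A))) (rowOp-colOp-invariants v u w x y z A)

-- Bézout relations, residues and inverse pairs.

bezoutℕ : ∀ m n → ∃₂ λ u v → + m * u + + n * v ≡ + gcd m n
bezoutℕ m n with Bézout.identity (gcd-GCD m n)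
... | Bézout.Identity.+- x y eq = + x , - + y , lemma (+ gcd m n) (+ x) (+ y) (+ m) (+ n)
    (trans (cong (λ t → + gcd m n + t) (sym (ℤₚ.pos-* y n))) (trans (cong +_ eq) (ℤₚ.pos-* x m)))
  where
  lemma : ∀ g x y m n → g + y * n ≡ x * m → m * x + n * (- y) ≡ g
  lemma g x y m n eq = lin₁ (- 1ℤ) eq (solve (g ∷ x ∷ y ∷ m ∷ n ∷ []))
... | Bézout.Identity.-+ x y eq = - + x , + y , lemma (+ gcd m n) (+ x) (+ y) (+ m) (+ n)
    (trans (cong (λ t → + gcd m n + t) (sym (ℤₚ.pos-* x m))) (trans (cong +_ eq) (ℤₚ.pos-* y n)))
  where
  lemma : ∀ g x y m n → g + x * m ≡ y * n → m * (- x) + n * y ≡ g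
  lemma g x y m n eq = lin₁ (- 1ℤ) eq (solve (g ∷ x ∷ y ∷ m ∷ n ∷ []))

bezout : ∀ m n → ∃₂ λ u v → m * u + n * v ≡ + gcd ∣ m ∣ ∣ n ∣
bezout m n with bezoutℕ ∣ m ∣ ∣ n ∣ | m∣∣m∣ {m} | m∣∣m∣ {n}
... | u , v , eq | divides s m≡ | divides t n≡ =
  s * u , t * v , trans (lemma m n u v s t) (trans (cong₂ (λ k l → k * u + l * v) (sym m≡) (sym n≡)) eq)
  where
  lemma : ∀ m n u v s t → m * (s * u) + n * (t * v) ≡ s * m * u + t * n * v
  lemma = solve-∀

∣∧<⇒≡0 : ∀ {m n} → n ℕD.∣ m → m ℕ.< n → m ≡ 0
∣∧<⇒≡0 {zero}  _   _   = refl
∣∧<⇒≡0 {suc m} n∣m m<n = contradiction n∣m (ℕD.>⇒∤ m<n)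

residue-unique : ∀ c {a b} k → a ℕ.< ∣ c ∣ → b ℕ.< ∣ c ∣ → + a ≡ + b + k * c → a ≡ b
residue-unique c {a} {b} k a<c b<c eq = ℕₚ.≤-antisym (half b<c a<c c∣b⊖a) (half a<c b<c c∣a⊖b)
  where
  half : ∀ {a b} → a ℕ.< ∣ c ∣ → b ℕ.< ∣ c ∣ → ∣ c ∣ ℕD.∣ ∣ a ℤ.⊖ b ∣ → b ℕ.≤ a
  half {a} {b} a<c b<c c∣ with ℕₚ.≤-total a b
  ... | inj₁ a≤b = ℕₚ.m∸n≡0⇒m≤n (∣∧<⇒≡0 (subst (_ ℕD.∣_) (ℤₚ.∣⊖∣-≤ a≤b) c∣) (ℕₚ.≤-<-trans (ℕₚ.m∸n≤m b a) b<c))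
  ... | inj₂ b≤a = b≤a
  difference : ∀ a b k c → a ≡ b + k * c → a - b ≡ k * c
  difference a b k c eq = lin₁ 1ℤ eq (solve (a ∷ b ∷ k ∷ c ∷ []))
  c∣a⊖b : ∣ c ∣ ℕD.∣ ∣ a ℤ.⊖ b ∣
  c∣a⊖b = ∣⇒∣ᵤ (divides k (trans (sym (ℤₚ.m-n≡m⊖n a b)) (difference (+ a) (+ b) k c eq)))
  c∣b⊖a : ∣ c ∣ ℕD.∣ ∣ b ℤ.⊖ a ∣
  c∣b⊖a = subst (∣ c ∣ ℕD.∣_) (ℤₚ.∣m⊖n∣≡∣n⊖m∣ a b) c∣a⊖b

-- The quotient `k` is kept as data because it becomes an entry of a block of `word`. If `c` is 1 or
-- -1, the only pair is `(0, 0)`, as in the classical sum.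
record InversePair (c : ℤ) (a d : ℕ) : Set where
  constructor inversePair
  field
    a<c : a ℕ.< ∣ c ∣
    d<c : d ℕ.< ∣ c ∣
    k   : ℤ
    ad≡ : + a * + d - 1ℤ ≡ k * c

InversePair-sym : ∀ {c a d} → InversePair c a d → InversePair c d a
InversePair-sym {a = a} {d} (inversePair a<c d<c k ad≡) =
  inversePair d<c a<c k (trans (cong (_- 1ℤ) (ℤₚ.*-comm (+ d) (+ a))) ad≡)

inverse-unique : ∀ {c a d d′} → InversePair c a d → InversePair c a d′ → d ≡ d′
inverse-unique {c} {a} {d} {d′} (inversePair _ d<c k ad≡) (inversePair _ d′<c k′ ad′≡) =
  residue-unique c (+ d * - k′ + + d′ * k) d<c d′<c (lemma (+ a) (+ d) (+ d′) k k′ c ad≡ ad′≡)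
  where
  lemma : ∀ a d d′ k k′ c → a * d - 1ℤ ≡ k * c → a * d′ - 1ℤ ≡ k′ * c → d ≡ d′ + (d * - k′ + d′ * k) * c
  lemma a d d′ k k′ c h h′ = lin₂ d′ h (- d) h′ (solve (a ∷ d ∷ d′ ∷ k ∷ k′ ∷ c ∷ []))

reduce : ∀ c z .{{_ : ℤ.NonZero c}} → Σ ℕ λ a → a ℕ.< ∣ c ∣ × Σ ℤ λ k → z ≡ + a + k * c
reduce c z = z % c , n%d<d z c , z / c , a≡a%n+[a/n]*n z c

reduce-unit : ∀ c z u v .{{_ : ℤ.NonZero c}} → z * u + c * v ≡ 1ℤ →
  ∃₂ λ a d → InversePair c a d × Σ ℤ λ k → z ≡ + a + k * c
reduce-unit c z u v eq with reduce c z | reduce c u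
... | a , a<c , k , z≡ | d , d<c , l , u≡ =
  a , d , inversePair a<c d<c (- v - k * + d - l * + a - k * l * c) (lemma c (+ a) k (+ d) l v z u eq z≡ u≡) , k , z≡
  where
  lemma : ∀ c a k d l v z u → z * u + c * v ≡ 1ℤ → z ≡ a + k * c → u ≡ d + l * c →
          a * d - 1ℤ ≡ (- v - k * d - l * a - k * l * c) * c
  lemma c a k d l v _ _ eq refl refl = lin₁ 1ℤ eq (solve (c ∷ a ∷ k ∷ d ∷ l ∷ v ∷ []))

-- Ring identities behind existence and uniqueness of the index.

-- ((x , y) , (b , p) , (r , s) , j) holds the residues of the word: xy ≡ 1 mod f, bp ≡ 1 mod d₁, rs ≡ 1 mod d₂, and S = s + d₂j.
Index : Set
Index = (ℕ × ℕ) × (ℕ × ℕ) × (ℕ × ℕ) × ℕ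

-- In the next identities A has bottom row (a, c, Y) = (d₁F, BF, Y) and bottom minors (m, M, N) = (d₂F, M, N), and
-- right multiplication by unip x′ y′ z′ moves (B, Y, M) to (b, y, d₂py + Sd₁).
bezout-quotient : ∀ d F B u v a c → a ≡ d * F → c ≡ B * F → a * u + c * v ≡ F → (B * v + d * u) * F ≡ 1ℤ * F
bezout-quotient d F B u v a c refl refl eq = lin₁ 1ℤ eq (solve (d ∷ F ∷ B ∷ u ∷ v ∷ []))

-- Modulo `F` the first two entries of the bottom row vanish, so only the `a33` term of the
-- determinant survives and `a33` is a unit.
bottom-row-unit : ∀ a b c d e g i d₁ B F →
  i * (a * e - b * d) + F * (d₁ * (b * g - c * e) - B * (a * g - c * d)) ≡
  a * (e * i - g * (B * F)) - b * (d * i - g * (d₁ * F)) + c * (d * (B * F) - e * (d₁ * F))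
bottom-row-unit = solve-∀

p*B : ∀ d₁ b p k q B → b * p - 1ℤ ≡ q * d₁ → B ≡ b + k * d₁ → p * B ≡ 1ℤ + (q + p * k) * d₁
p*B d₁ b p k q _ eq refl = lin₁ 1ℤ eq (solve (d₁ ∷ b ∷ p ∷ k ∷ q ∷ []))

plücker-quotient : ∀ d₁ d₂ F B Y M N a c m → a ≡ d₁ * F → c ≡ B * F → m ≡ d₂ * F →
  a * N ≡ c * M - Y * m → (d₁ * N) * F ≡ (B * M - Y * d₂) * F
plücker-quotient d₁ d₂ F B Y M N _ _ _ refl refl refl eq = lin₁ 1ℤ eq (solve (d₁ ∷ d₂ ∷ F ∷ B ∷ Y ∷ M ∷ N ∷ []))

-- The Bézout relation scaled by `- t`: adding these multiples of the first two columns to the third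
-- changes its bottom entry by `- tF`, from `Y` to `y`.
shift : ∀ d₁ B u v t → B * v + d₁ * u ≡ 1ℤ → (- t * u) * d₁ + (- t * v) * B ≡ - t
shift d₁ B u v t eq = lin₁ (- t) eq (solve (d₁ ∷ B ∷ u ∷ v ∷ t ∷ []))

-- `W = M + z′d₂F - d₂py` is what has to become `S d₁`. Modulo `d₁`, the Plücker relation gives
-- `BM = Yd₂`, while `Bz′ = - t` and `Bp = 1`, so `BW = d₂(Y - tF - y) = 0`. As `B` is a unit modulo
-- `d₁`, `W-quotient` can then divide.
B*W : ∀ d₁ d₂ F B M N p q y y′ z′ t Y → d₁ * N ≡ B * M - Y * d₂ → y′ * d₁ + z′ * B ≡ - t → p * B ≡ 1ℤ + q * d₁ → Y ≡ y + t * F →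
  B * (M + z′ * (d₂ * F) - d₂ * p * y) ≡ d₁ * (N - d₂ * F * y′ - d₂ * y * q)
B*W d₁ d₂ F B M N p q y y′ z′ t _ h₁ h₂ h₃ refl =
  lin₃ (- 1ℤ) h₁ (d₂ * F) h₂ (- (d₂ * y)) h₃ (solve (d₁ ∷ d₂ ∷ F ∷ B ∷ M ∷ N ∷ p ∷ q ∷ y ∷ y′ ∷ z′ ∷ t ∷ []))

W-quotient : ∀ d₁ B W G u v → B * W ≡ d₁ * G → B * v + d₁ * u ≡ 1ℤ → W ≡ (v * G + u * W) * d₁
W-quotient d₁ B W G u v h₁ h₂ = lin₂ v h₁ (- W) h₂ (solve (d₁ ∷ B ∷ W ∷ G ∷ u ∷ v ∷ []))

m23-value : ∀ d₁ d₂ F B M N S p q y y′ z′ t Y → d₁ * N ≡ B * M - Y * d₂ → y′ * d₁ + z′ * B ≡ - t → p * B ≡ 1ℤ + q * d₁ →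
  Y ≡ y + t * F → M + z′ * (d₂ * F) - d₂ * p * y ≡ S * d₁ → d₁ * N ≡ d₁ * (B * S + d₂ * (q * y + y′ * F))
m23-value d₁ d₂ F B M N S p q y y′ z′ t _ h₁ h₂ h₃ refl h₄ =
  lin₁ 1ℤ h₁ (lin₃ B h₄ (- (d₂ * F)) h₂ (d₂ * y) h₃ (solve (d₁ ∷ d₂ ∷ F ∷ B ∷ M ∷ N ∷ S ∷ p ∷ q ∷ y ∷ y′ ∷ z′ ∷ t ∷ [])))

-- The determinant expanded along the top row is `aN - bM + cm`. Modulo `d₂` the last term vanishes,
-- `N = BS` and `M = Sd₁`, so `aB - bd₁` is an inverse of `S`.
S-unit : ∀ a b c d₁ d₂ F B M N S p y z′ K m → a * N - b * M + c * m ≡ 1ℤ → m ≡ d₂ * F → N ≡ B * S + d₂ * K → M + z′ * (d₂ * F) - d₂ * p * y ≡ S * d₁ →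
  S * (a * B - b * d₁) + d₂ * (a * K - b * (p * y - z′ * F) + c * F) ≡ 1ℤ
S-unit a b c d₁ d₂ F B M _ S p y z′ K _ h₁ refl refl h₂ =
  lin₂ 1ℤ h₁ b h₂ (solve (a ∷ b ∷ c ∷ d₁ ∷ d₂ ∷ F ∷ B ∷ M ∷ S ∷ p ∷ y ∷ z′ ∷ K ∷ []))

reduced-col2 : ∀ d₁ F B b k a c → a ≡ d₁ * F → c ≡ B * F → B ≡ b + k * d₁ → b * F ≡ c + (- k) * a
reduced-col2 d₁ F _ b k _ _ refl refl refl = solve (d₁ ∷ F ∷ b ∷ k ∷ [])

-- The pair `(B, - d₁)` annihilates the first two bottom entries, so `l` is free here; `reduced-m13`
-- uses it to bring `S` into its range modulo `d₂F`.
reduced-col3 : ∀ d₁ F B Y y y′ z′ t l a c → a ≡ d₁ * F → c ≡ B * F → y′ * d₁ + z′ * B ≡ - t → Y ≡ y + t * F →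
  y ≡ Y + (y′ + B * l) * a + (z′ - d₁ * l) * c
reduced-col3 d₁ F B _ y y′ z′ t l _ _ refl refl h refl = lin₁ (- F) h (solve (d₁ ∷ F ∷ B ∷ y ∷ y′ ∷ z′ ∷ t ∷ l ∷ []))

reduced-m13 : ∀ d₁ d₂ F M S p y z′ s j k l m → m ≡ d₂ * F → M + z′ * (d₂ * F) - d₂ * p * y ≡ S * d₁ → S ≡ s + k * d₂ → k ≡ j + l * F →
  d₂ * p * y + (s + d₂ * j) * d₁ ≡ M + (z′ - d₁ * l) * m
reduced-m13 d₁ d₂ F M _ p y z′ s j _ l _ refl h refl refl = lin₁ (- 1ℤ) h (solve (d₁ ∷ d₂ ∷ F ∷ M ∷ p ∷ y ∷ z′ ∷ s ∷ j ∷ l ∷ []))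

unique-b : ∀ d F b b′ x x′ a c → a ≡ d * F → b * F ≡ c + x * a → b′ * F ≡ c + x′ * a → b * F ≡ (b′ + (x - x′) * d) * F
unique-b d F b b′ x x′ _ c refl h h′ = lin₂ 1ℤ h (- 1ℤ) h′ (solve (d ∷ F ∷ b ∷ b′ ∷ x ∷ x′ ∷ c ∷ []))

unique-y : ∀ d F b x y y′ z z′ Y η η′ a c → a ≡ d * F → b * F ≡ c + x * a → η ≡ Y + y * a + z * c → η′ ≡ Y + y′ * a + z′ * c →
  η ≡ η′ + ((y - y′) * d + (z - z′) * (b - x * d)) * F
unique-y d F b x y y′ z z′ Y _ _ _ c refl h refl refl = lin₁ (- (z - z′)) h (solve (d ∷ F ∷ b ∷ x ∷ y ∷ y′ ∷ z ∷ z′ ∷ Y ∷ c ∷ []))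

unique-y-shift : ∀ η η′ k F → η ≡ η′ → η ≡ η′ + k * F → k * F ≡ 0ℤ * F
unique-y-shift η _ k F refl h = lin₁ (- 1ℤ) h (solve (η ∷ k ∷ F ∷ []))

-- For two indices with the same `y`, the relation between `E` and `D` says that `bD` vanishes
-- modulo `d`; multiplying by `p` removes `b`.
unique-z : ∀ d b p q x D E → b * p - 1ℤ ≡ q * d → E * d + D * (b - x * d) ≡ 0ℤ → D ≡ (- (p * E) - D * (q - p * x)) * d
unique-z d b p q x D E h h′ = lin₂ (- D) h p h′ (solve (d ∷ b ∷ p ∷ q ∷ x ∷ D ∷ E ∷ []))

unique-S : ∀ d₁ d₂ F p p′ y y′ S S′ M z z′ m l → p ≡ p′ → y ≡ y′ → m ≡ d₂ * F → z - z′ ≡ l * d₁ →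
  d₂ * p * y + S * d₁ ≡ M + z * m → d₂ * p′ * y′ + S′ * d₁ ≡ M + z′ * m → S * d₁ ≡ (S′ + l * (d₂ * F)) * d₁
unique-S d₁ d₂ F p _ y _ S S′ M z z′ _ l refl refl refl h h₁ h₂ =
  lin₃ (d₂ * F) h 1ℤ h₁ (- 1ℤ) h₂ (solve (d₁ ∷ d₂ ∷ F ∷ p ∷ y ∷ S ∷ S′ ∷ M ∷ z ∷ z′ ∷ l ∷ []))

unique-s : ∀ d₂ F s s′ j j′ l → s + d₂ * j ≡ s′ + d₂ * j′ + l * (d₂ * F) → s ≡ s′ + (j′ - j + l * F) * d₂
unique-s d₂ F s s′ j j′ l h = lin₁ 1ℤ h (solve (d₂ ∷ F ∷ s ∷ s′ ∷ j ∷ j′ ∷ l ∷ []))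

unique-j : ∀ d₂ F s s′ j j′ l → s ≡ s′ → s + d₂ * j ≡ s′ + d₂ * j′ + l * (d₂ * F) → j * d₂ ≡ (j′ + l * F) * d₂
unique-j d₂ F s _ j j′ l refl h = lin₁ 1ℤ h (solve (d₂ ∷ F ∷ s ∷ j ∷ j′ ∷ l ∷ []))

-- Multiplicativity of the determinant for three embedded 2 × 2 blocks, stated with free entries so
-- that each block determinant can be set to 1 separately.
det-word : ∀ r t d₂ s α β f y p q d₁ b →
  (r * p + t * α * d₁) * ((d₂ * q + s * α * b) * y - (s * β) * (b * f))
  - (r * q + t * α * b) * ((d₂ * p + s * α * d₁) * y - (s * β) * (d₁ * f))
  + (t * β) * ((d₂ * p + s * α * d₁) * (b * f) - (d₂ * q + s * α * b) * (d₁ * f))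
  ≡ (r * s - t * d₂) * ((α * y - β * f) * (b * p - q * d₁))
det-word = solve-∀

minus : ∀ a k c → a - 1ℤ ≡ k * c → a - k * c ≡ 1ℤ
minus a k c h = lin₁ 1ℤ h (solve (a ∷ k ∷ c ∷ []))

minus-S : ∀ d₂ r s j l → r * s - 1ℤ ≡ l * d₂ → r * (s + d₂ * j) - (l + r * j) * d₂ ≡ 1ℤ
minus-S d₂ r s j l h = lin₁ 1ℤ h (solve (d₂ ∷ r ∷ s ∷ j ∷ l ∷ []))

-- The multiple `X` of the row `(d₁, b)` does not affect the minor against `F (d₁, b)`. Both `N12`
-- and `minor2` of a word have this shape, with `d = r` and `d = d₂`.
minor-word : ∀ d₁ F b p q d X → b * p - 1ℤ ≡ q * d₁ →
  (d * p + X * d₁) * (b * F) - (d * q + X * b) * (d₁ * F) ≡ d * F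
minor-word d₁ F b p q d X h = lin₁ (d * F) h (solve (d₁ ∷ F ∷ b ∷ p ∷ q ∷ d ∷ X ∷ []))

m13-wordℤ : ∀ d₁ d₂ F S x y p k → x * y - 1ℤ ≡ k * F →
  (d₂ * p + S * x * d₁) * y - S * k * (d₁ * F) ≡ d₂ * p * y + S * d₁
m13-wordℤ d₁ d₂ F S x y p k h = lin₁ (S * d₁) h (solve (d₁ ∷ d₂ ∷ F ∷ S ∷ x ∷ y ∷ p ∷ k ∷ []))

-- Indices of matrices, and the words that realise them.

module DoubleCosets (d₁ d₂ : ℤ) (f : ℕ)
  .{{_ : ℤ.NonZero d₁}} .{{_ : ℤ.NonZero d₂}} .{{_ : NonZero f}} where

  IsIndex : Index → Set
  IsIndex ((x , y) , (b , p) , (r , s) , j) =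
    InversePair (+ f) x y × InversePair d₁ b p × InversePair d₂ r s × j ℕ.< f

  -- Right multiplication by Γ∞ brings the Plücker coordinates of A to those of the word with index J.
  HasIndex : Mat3 → Index → Set
  HasIndex A ((x , y) , (b , p) , (r , s) , j) =
    Σ ℤ λ x′ → Σ ℤ λ y′ → Σ ℤ λ z′ →
      + b * + f ≡ a32 A + x′ * a31 A ×
      + y ≡ a33 A + y′ * a31 A + z′ * a32 A ×
      d₂ * + p * + y + (+ s + d₂ * + j) * d₁ ≡ m13 A + z′ * minor2 A

  -- Dividing the Bézout relation of `a31` and `a32` by their gcd `f` shows that `B` is prime to
  -- `d₁`.
  a32-factor : ∀ A → InΩ d₁ d₂ f A →
    Σ ℤ λ B → a32 A ≡ B * + f × ∃₂ λ u v → B * v + d₁ * u ≡ 1ℤ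
  a32-factor A (_ , gcd≡f , e₃₁ , _) = factor (∣ᵤ⇒∣ f∣a32) (bezout (a31 A) (a32 A))
    where
    f∣a32 : f ℕD.∣ ∣ a32 A ∣
    f∣a32 = subst (ℕD._∣ ∣ a32 A ∣) gcd≡f (gcd[m,n]∣n ∣ a31 A ∣ ∣ a32 A ∣)
    factor : + f ∣ℤ a32 A → (∃₂ λ u v → a31 A * u + a32 A * v ≡ + gcd ∣ a31 A ∣ ∣ a32 A ∣) →
             Σ ℤ λ B → a32 A ≡ B * + f × ∃₂ λ u v → B * v + d₁ * u ≡ 1ℤ
    factor (divides B e₃₂) (u , v , uv≡) = B , e₃₂ , u , v ,
      ℤₚ.*-cancelʳ-≡ (B * v + d₁ * u) 1ℤ (+ f)
        (bezout-quotient d₁ (+ f) B u v (a31 A) (a32 A) e₃₁ e₃₂ (trans uv≡ (cong +_ gcd≡f)))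

  a33-unit : ∀ A B → det3 A ≡ 1ℤ → a31 A ≡ d₁ * + f → a32 A ≡ B * + f → ∃₂ λ u v → a33 A * u + + f * v ≡ 1ℤ
  a33-unit (mat3 a b c d e g _ _ i) B det≡1 refl refl =
    a * e - b * d , d₁ * (b * g - c * e) - B * (a * g - c * d) ,
    trans (bottom-row-unit a b c d e g i d₁ B (+ f)) det≡1

  S-exists : ∀ F B M N p q y y′ z′ t Y u v →
    d₁ * N ≡ B * M - Y * d₂ → y′ * d₁ + z′ * B ≡ - t → p * B ≡ 1ℤ + q * d₁ → Y ≡ y + t * F → B * v + d₁ * u ≡ 1ℤ →
    ∃₂ λ S K → M + z′ * (d₂ * F) - d₂ * p * y ≡ S * d₁ × N ≡ B * S + d₂ * K
  S-exists F B M N p q y y′ z′ t Y u v plück shift≡ pB≡ Y≡ unit₁ =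
    S , K , W≡ , ℤₚ.*-cancelˡ-≡ d₁ N (B * S + d₂ * K) (m23-value d₁ d₂ F B M N S p q y y′ z′ t Y plück shift≡ pB≡ Y≡ W≡)
    where
    W = M + z′ * (d₂ * F) - d₂ * p * y
    G = N - d₂ * F * y′ - d₂ * y * q
    S = v * G + u * W
    K = q * y + y′ * F
    W≡ = W-quotient d₁ B W G u v (B*W d₁ d₂ F B M N p q y y′ z′ t Y plück shift≡ pB≡ Y≡) unit₁

  module _ (A : Mat3) (A∈Ω : InΩ d₁ d₂ f A) where
    private
      det≡1 = proj₁ A∈Ω
      e₃₁ = proj₁ (proj₂ (proj₂ A∈Ω))
      e₁₂ = proj₂ (proj₂ (proj₂ A∈Ω))

      Goal : Set
      Goal = Σ Index λ J → IsIndex J × HasIndex A J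

      S-reduced : ∀ B u v k₁ t {β p y x} → a32 A ≡ B * + f → B * v + d₁ * u ≡ 1ℤ →
        InversePair d₁ β p → B ≡ + β + k₁ * d₁ → InversePair (+ f) y x → a33 A ≡ + y + t * + f →
        ∀ S → m13 A + (- t * v) * (d₂ * + f) - d₂ * + p * + y ≡ S * d₁ →
        (∃₂ λ s r → InversePair d₂ s r × Σ ℤ λ k → S ≡ + s + k * d₂ × Σ ℕ λ j → j ℕ.< f × Σ ℤ λ l → k ≡ + j + l * + f) → Goal
      S-reduced B u v k₁ t {β} {p} {y} {x} e₃₂ unit₁ pair₁ B≡ pair₂ Y≡ S W≡ (s , r , pair₃ , k₂ , S≡ , j , j<f , l , k₂≡) =
        ((x , y) , (β , p) , (r , s) , j) ,
        (InversePair-sym pair₂ , pair₁ , InversePair-sym pair₃ , j<f) ,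
        -- The multipliers of `shift` plus `l` times the pair `(B, - d₁)`.
        (- k₁ , - t * u + B * l , - t * v - d₁ * l ,
         reduced-col2 d₁ (+ f) B (+ β) k₁ (a31 A) (a32 A) e₃₁ e₃₂ B≡ ,
         reduced-col3 d₁ (+ f) B (a33 A) (+ y) (- t * u) (- t * v) t l (a31 A) (a32 A) e₃₁ e₃₂ (shift d₁ B u v t unit₁) Y≡ ,
         reduced-m13 d₁ d₂ (+ f) (m13 A) S (+ p) (+ y) (- t * v) (+ s) (+ j) k₂ l (minor2 A) e₁₂ W≡ S≡ k₂≡)

      bottom-reduced : ∀ B u v → a32 A ≡ B * + f → B * v + d₁ * u ≡ 1ℤ →
        (∃₂ λ β p → InversePair d₁ β p × Σ ℤ λ k → B ≡ + β + k * d₁) →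
        (∃₂ λ y x → InversePair (+ f) y x × Σ ℤ λ t → a33 A ≡ + y + t * + f) → Goal
      bottom-reduced B u v e₃₂ unit₁ (β , p , pair₁@(inversePair _ _ q βp≡) , k₁ , B≡) (y , x , pair₂ , t , Y≡) =
        S-reduced B u v k₁ t e₃₂ unit₁ pair₁ B≡ pair₂ Y≡ S W≡
          (let s , r , pair₃ , k₂ , S≡ = reduce-unit d₂ S (a11 A * B - a12 A * d₁) (a11 A * K - a12 A * (+ p * + y - (- t * v) * + f) + a13 A * + f)
                 (S-unit (a11 A) (a12 A) (a13 A) d₁ d₂ (+ f) B (m13 A) (m23 A) S (+ p) (+ y) (- t * v) K (minor2 A) det≡1 e₁₂ N≡ W≡)
           in s , r , pair₃ , k₂ , S≡ , reduce (+ f) k₂)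
        where
        S-data : ∃₂ λ S K → m13 A + (- t * v) * (d₂ * + f) - d₂ * + p * + y ≡ S * d₁ × m23 A ≡ B * S + d₂ * K
        S-data = S-exists (+ f) B (m13 A) (m23 A) (+ p) (q + + p * k₁) (+ y) (- t * u) (- t * v) t (a33 A) u v
           (ℤₚ.*-cancelʳ-≡ (d₁ * m23 A) (B * m13 A - a33 A * d₂) (+ f)
             (plücker-quotient d₁ d₂ (+ f) B (a33 A) (m13 A) (m23 A) (a31 A) (a32 A) (minor2 A) e₃₁ e₃₂ e₁₂ (plücker A)))
           (shift d₁ B u v t unit₁) (p*B d₁ (+ β) (+ p) k₁ q B βp≡ B≡) Y≡ unit₁
        S = proj₁ S-data
        K = proj₁ (proj₂ S-data)
        W≡ = proj₁ (proj₂ (proj₂ S-data))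
        N≡ = proj₂ (proj₂ (proj₂ S-data))

    index-exists : Σ Index λ J → IsIndex J × HasIndex A J
    index-exists =
      let B , e₃₂ , u , v , unit₁ = a32-factor A A∈Ω
          u₂ , v₂ , unit₂ = a33-unit A B det≡1 e₃₁ e₃₂
      in bottom-reduced B u v e₃₂ unit₁ (reduce-unit d₁ B v u unit₁) (reduce-unit (+ f) (a33 A) u₂ v₂ unit₂)

  index-unique : ∀ A → a31 A ≡ d₁ * + f → minor2 A ≡ d₂ * + f →
    ∀ J J′ → IsIndex J → IsIndex J′ → HasIndex A J → HasIndex A J′ → J ≡ J′
  index-unique A e₃₁ e₁₂ ((x , y) , (b , p) , (r , s) , j) ((x′ , y′) , (b′ , p′) , (r′ , s′) , j′)
    (P , Q@(inversePair b< p< q bp≡) , R , j<) (P′ , Q′ , R′ , j<′) (u , v , w , h₁ , h₂ , h₃) (u′ , v′ , w′ , h₁′ , h₂′ , h₃′) =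
    cong₂ _,_ (cong₂ _,_ x≡ y≡) (cong₂ _,_ (cong₂ _,_ b≡ p≡) (cong₂ _,_ (cong₂ _,_ r≡ s≡) j≡))
    where
    F B D E l S S′ : ℤ
    F = + f
    B = + b - u * d₁
    D = w - w′
    E = v - v′
    l = - (+ p * E) - D * (q - + p * u)
    S = + s + d₂ * + j
    S′ = + s′ + d₂ * + j′
    b≡ : b ≡ b′
    b≡ = residue-unique d₁ (u - u′) b< (InversePair.a<c Q′)
      (ℤₚ.*-cancelʳ-≡ (+ b) (+ b′ + (u - u′) * d₁) F (unique-b d₁ F (+ b) (+ b′) u u′ (a31 A) (a32 A) e₃₁ h₁ h₁′))
    p≡ : p ≡ p′
    p≡ = inverse-unique (subst (λ b → InversePair d₁ b p) b≡ Q) Q′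
    y-diff : + y ≡ + y′ + (E * d₁ + D * B) * F
    y-diff = unique-y d₁ F (+ b) u v v′ w w′ (a33 A) (+ y) (+ y′) (a31 A) (a32 A) e₃₁ h₁ h₂ h₂′
    y≡ : y ≡ y′
    y≡ = residue-unique F (E * d₁ + D * B) (InversePair.d<c P) (InversePair.d<c P′) y-diff
    x≡ : x ≡ x′
    x≡ = inverse-unique (InversePair-sym (subst (λ y → InversePair F x y) y≡ P)) (InversePair-sym P′)
    -- Once `y` agrees, the two right multipliers differ by an element fixing the bottom row, and
    -- such elements move `S` only by multiples of `d₂F`.
    D≡ : D ≡ l * d₁
    D≡ = unique-z d₁ (+ b) (+ p) q u D E bp≡
      (ℤₚ.*-cancelʳ-≡ (E * d₁ + D * B) 0ℤ F (unique-y-shift (+ y) (+ y′) (E * d₁ + D * B) F (cong +_ y≡) y-diff))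
    S≡ : S ≡ S′ + l * (d₂ * F)
    S≡ = ℤₚ.*-cancelʳ-≡ S (S′ + l * (d₂ * F)) d₁
      (unique-S d₁ d₂ F (+ p) (+ p′) (+ y) (+ y′) S S′ (m13 A) w w′ (minor2 A) l (cong +_ p≡) (cong +_ y≡) e₁₂ D≡ h₃ h₃′)
    s≡ : s ≡ s′
    s≡ = residue-unique d₂ (+ j′ - + j + l * F) (InversePair.d<c R) (InversePair.d<c R′) (unique-s d₂ F (+ s) (+ s′) (+ j) (+ j′) l S≡)
    r≡ : r ≡ r′
    r≡ = inverse-unique (InversePair-sym (subst (λ s → InversePair d₂ r s) s≡ R)) (InversePair-sym R′)
    j≡ : j ≡ j′
    j≡ = residue-unique F l j< j<′
      (ℤₚ.*-cancelʳ-≡ (+ j) (+ j′ + l * F) d₂ (unique-j d₂ F (+ s) (+ s′) (+ j) (+ j′) l (cong +_ s≡) S≡))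

  word : ∀ J → IsIndex J → Mat3
  word ((x , y) , (b , p) , (r , s) , j) (inversePair _ _ k _ , inversePair _ _ q _ , inversePair _ _ l _ , _) =
    let S = + s + d₂ * + j
        -- This choice keeps the block determinant: `rS - td₂ = rs - ld₂ = 1`.
        t = l + + r * + j
    in mat3 (+ r * + p + t * + x * d₁) (+ r * q + t * + x * + b) (t * k)
            (d₂ * + p + S * + x * d₁)  (d₂ * q + S * + x * + b)  (S * k)
            (d₁ * + f)                 (+ b * + f)               (+ y)

  coprime-bottom : ∀ b {p q} → + b * + p - 1ℤ ≡ q * d₁ → gcd (∣ d₁ * + f ∣) (∣ + b * + f ∣) ≡ f
  coprime-bottom b {p} {q} h = begin
    gcd (∣ d₁ * + f ∣) (∣ + b * + f ∣)   ≡⟨ cong₂ gcd (scale d₁) (scale (+ b)) ⟩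
    gcd (f ℕ.* (∣ d₁ ∣)) (f ℕ.* b)       ≡⟨ c*gcd[m,n]≡gcd[cm,cn] f (∣ d₁ ∣) b ⟨
    f ℕ.* g                              ≡⟨ cong (f ℕ.*_) (ℕD.∣1⇒≡1 (∣⇒∣ᵤ {+ g} {1ℤ} g∣1)) ⟩
    f ℕ.* 1                              ≡⟨ ℕₚ.*-identityʳ f ⟩
    f                                    ∎
    where
    open ≡-Reasoning
    g : ℕ
    g = gcd (∣ d₁ ∣) b
    g∣1 : + g ∣ℤ 1ℤ
    g∣1 = subst (+ g ∣ℤ_) (minus (+ b * + p) q d₁ h)
      (∣m∣n⇒∣m-n (∣m⇒∣m*n (+ p) (∣ᵤ⇒∣ {+ g} {+ b} (gcd[m,n]∣n (∣ d₁ ∣) b)))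
                 (∣n⇒∣m*n q (∣ᵤ⇒∣ {+ g} {d₁} (gcd[m,n]∣m (∣ d₁ ∣) b))))
    scale : ∀ z → ∣ z * + f ∣ ≡ f ℕ.* ∣ z ∣
    scale z = trans (ℤₚ.abs-* z (+ f)) (ℕₚ.*-comm (∣ z ∣) f)

  module _ J (valid : IsIndex J) where
    N12-word : N12 (word J valid) ≡ + proj₁ (proj₁ (proj₂ (proj₂ J))) * + f
    N12-word = let (x , _) , (b , p) , (r , _) , j = J ; _ , inversePair _ _ q h , inversePair _ _ l _ , _ = valid
               in minor-word d₁ (+ f) (+ b) (+ p) q (+ r) ((l + + r * + j) * + x) h

    minor2-word : minor2 (word J valid) ≡ d₂ * + f
    minor2-word = let (x , _) , (b , p) , (_ , s) , j = J ; _ , inversePair _ _ q h , _ = valid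
                  in minor-word d₁ (+ f) (+ b) (+ p) q d₂ ((+ s + d₂ * + j) * + x) h

    m13-word : let (_ , y) , (_ , p) , (_ , s) , j = J in m13 (word J valid) ≡ d₂ * + p * + y + (+ s + d₂ * + j) * d₁
    m13-word = let (x , y) , (_ , p) , (_ , s) , j = J ; inversePair _ _ k h , _ = valid
               in m13-wordℤ d₁ d₂ (+ f) (+ s + d₂ * + j) (+ x) (+ y) (+ p) k h

    word∈Ω : InΩ d₁ d₂ f (word J valid)
    word∈Ω = let (x , y) , (b , p) , (r , s) , j = J ; inversePair _ _ k hx , inversePair _ _ q hb , inversePair _ _ l hr , _ = valid in
      trans (det-word (+ r) (l + + r * + j) d₂ (+ s + d₂ * + j) (+ x) k (+ f) (+ y) (+ p) q d₁ (+ b))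
        (cong₂ _*_ (minus-S d₂ (+ r) (+ s) (+ j) l hr) (cong₂ _*_ (minus (+ x * + y) k (+ f) hx) (minus (+ b * + p) q d₁ hb))) ,
      coprime-bottom b {p} {q} hb , refl , minor2-word

    module _ A (A∈Ω : InΩ d₁ d₂ f A) where
      private
        e₃₁ = proj₁ (proj₂ (proj₂ A∈Ω))
        e₁₂ = proj₂ (proj₂ (proj₂ A∈Ω))

      hasIndex⇒sameDoubleCoset : HasIndex A J → SameDoubleCoset A (word J valid)
      hasIndex⇒sameDoubleCoset (x , y , z , h₁ , h₂ , h₃) =
        sameDoubleCoset A (word J valid) x y z (proj₁ A∈Ω) (proj₁ word∈Ω) {{a31≢0}}
          (sym e₃₁) h₁ h₂ (trans minor2-word (sym e₁₂)) (trans m13-word h₃)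
        where
        a31≢0 : ℤ.NonZero (a31 A)
        a31≢0 = subst ℤ.NonZero (sym e₃₁) (ℤₚ.i*j≢0 d₁ (+ f))

      sameDoubleCoset⇒hasIndex : SameDoubleCoset A (word J valid) → HasIndex A J
      sameDoubleCoset⇒hasIndex A~word =
        let open CosetInvariants (sameDoubleCoset⁻¹ A (word J valid) A~word)
        in x , y , z , a32≡ , a33≡ , trans (sym m13-word) m13≡

-- The character on fractions with signed denominators.

frac-cong⁺ : ∀ p p′ n n′ → p * + suc n′ ≡ p′ * + suc n → frac p (+ suc n) ≡ frac p′ (+ suc n′)
frac-cong⁺ p p′ n n′ eq = ℚₚ.fromℚᵘ-cong {mkℚᵘ p n} {mkℚᵘ p′ n′} (*≡* eq)

frac-cong : ∀ p q p′ q′ .{{_ : ℤ.NonZero q}} .{{_ : ℤ.NonZero q′}} → p * q′ ≡ p′ * q → frac p q ≡ frac p′ q′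
frac-cong p (+ suc n)  p′ (+ suc n′)  eq = frac-cong⁺ p p′ n n′ eq
frac-cong p (+ suc n)  p′ -[1+ n′ ] eq = frac-cong⁺ p (- p′) n n′ (lemma p (+ suc n) p′ (+ suc n′) eq)
  where
  lemma : ∀ p q p′ q′ → p * - q′ ≡ p′ * q → p * q′ ≡ (- p′) * q
  lemma p q p′ q′ h = lin₁ (- 1ℤ) h (solve (p ∷ q ∷ p′ ∷ q′ ∷ []))
frac-cong p -[1+ n ] p′ (+ suc n′)  eq = frac-cong⁺ (- p) p′ n n′ (lemma p (+ suc n) p′ (+ suc n′) eq)
  where
  lemma : ∀ p q p′ q′ → p * q′ ≡ p′ * - q → (- p) * q′ ≡ p′ * q
  lemma p q p′ q′ h = lin₁ (- 1ℤ) h (solve (p ∷ q ∷ p′ ∷ q′ ∷ []))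
frac-cong p -[1+ n ] p′ -[1+ n′ ] eq = frac-cong⁺ (- p) (- p′) n n′ (lemma p (+ suc n) p′ (+ suc n′) eq)
  where
  lemma : ∀ p q p′ q′ → p * - q′ ≡ p′ * - q → (- p) * q′ ≡ (- p′) * q
  lemma p q p′ q′ h = lin₁ 1ℤ h (solve (p ∷ q ∷ p′ ∷ q′ ∷ []))

frac-+⁺ : ∀ p p′ n → frac (p + p′) (+ suc n) ≡ frac p (+ suc n) ℚ.+ frac p′ (+ suc n)
frac-+⁺ p p′ n = ℚₚ.toℚᵘ-injective (begin
  ℚ.toℚᵘ (ℚ.fromℚᵘ (mkℚᵘ (p + p′) n))                 ≈⟨ ℚₚ.toℚᵘ-fromℚᵘ (mkℚᵘ (p + p′) n) ⟩
  mkℚᵘ (p + p′) n                                     ≈⟨ *≡* (lemma p p′ (+ suc n)) ⟩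
  mkℚᵘ p n ℚᵘ.+ mkℚᵘ p′ n                             ≈⟨ ℚᵘₚ.+-cong (ℚₚ.toℚᵘ-fromℚᵘ (mkℚᵘ p n)) (ℚₚ.toℚᵘ-fromℚᵘ (mkℚᵘ p′ n)) ⟨
  ℚ.toℚᵘ (frac p (+ suc n)) ℚᵘ.+ ℚ.toℚᵘ (frac p′ (+ suc n))  ≈⟨ ℚₚ.toℚᵘ-homo-+ (frac p (+ suc n)) (frac p′ (+ suc n)) ⟨
  ℚ.toℚᵘ (frac p (+ suc n) ℚ.+ frac p′ (+ suc n))     ∎)
  where
  open ℚᵘₚ.≃-Reasoning
  lemma : ∀ p p′ q → (p + p′) * (q * q) ≡ (p * q + p′ * q) * q
  lemma = solve-∀

frac-+ : ∀ p p′ q .{{_ : ℤ.NonZero q}} → frac (p + p′) q ≡ frac p q ℚ.+ frac p′ q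
frac-+ p p′ (+ suc n)  = frac-+⁺ p p′ n
frac-+ p p′ -[1+ n ] = trans (cong (λ t → frac t (+ suc n)) (ℤₚ.neg-distrib-+ p p′)) (frac-+⁺ (- p) (- p′) n)

frac-*⁺ : ∀ m p n → ℤ→ℚ m ℚ.* frac p (+ suc n) ≡ frac (m * p) (+ suc n)
frac-*⁺ m p n = ℚₚ.toℚᵘ-injective (begin
  ℚ.toℚᵘ (ℤ→ℚ m ℚ.* frac p (+ suc n))              ≈⟨ ℚₚ.toℚᵘ-homo-* (ℤ→ℚ m) (frac p (+ suc n)) ⟩
  ℚ.toℚᵘ (ℤ→ℚ m) ℚᵘ.* ℚ.toℚᵘ (frac p (+ suc n))    ≈⟨ ℚᵘₚ.*-cong (ℚₚ.toℚᵘ-fromℚᵘ (mkℚᵘ m 0)) (ℚₚ.toℚᵘ-fromℚᵘ (mkℚᵘ p n)) ⟩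
  mkℚᵘ m 0 ℚᵘ.* mkℚᵘ p n                           ≈⟨ *≡* (lemma m p (+ suc n)) ⟩
  mkℚᵘ (m * p) n                                   ≈⟨ ℚₚ.toℚᵘ-fromℚᵘ (mkℚᵘ (m * p) n) ⟨
  ℚ.toℚᵘ (frac (m * p) (+ suc n))                  ∎)
  where
  open ℚᵘₚ.≃-Reasoning
  lemma : ∀ m p q → (m * p) * q ≡ (m * p) * (1ℤ * q)
  lemma = solve-∀

frac-* : ∀ m p q .{{_ : ℤ.NonZero q}} → ℤ→ℚ m ℚ.* frac p q ≡ frac (m * p) q
frac-* m p (+ suc n)  = frac-*⁺ m p n
frac-* m p -[1+ n ] = trans (frac-*⁺ m (- p) n) (cong (λ t → frac t (+ suc n)) (sym (ℤₚ.neg-distribʳ-* m p)))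

frac-integral : ∀ p f z .{{_ : NonZero f}} → frac p (+ f) ≡ ℤ→ℚ z → p ≡ z * + f
frac-integral p (suc n) z eq with *≡* h ← ℚₚ.fromℚᵘ-injective {mkℚᵘ p n} {mkℚᵘ z 0} eq =
  trans (sym (ℤₚ.*-identityʳ p)) h

module Character {c ℓ} (R : CommutativeRing c ℓ) (e : ℚ → CommutativeRing.Carrier R) (e-char : IsStdChar R e) where
  open CommutativeRing R using (Carrier; _≈_; 1#; *-congˡ; *-identityʳ; setoid; reflexive)
    renaming (_*_ to _·_; refl to ≈-refl; trans to ≈-trans)
  open import Relation.Binary.Reasoning.Setoid setoid

  E : ℤ → ℤ → Carrier
  E p q = e (frac p q)

  E-+ : ∀ p p′ q .{{_ : ℤ.NonZero q}} → E (p + p′) q ≈ E p q · E p′ q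
  E-+ p p′ q = ≈-trans (reflexive (cong e (frac-+ p p′ q))) (proj₁ e-char (frac p q) (frac p′ q))

  E-cong : ∀ p q p′ q′ .{{_ : ℤ.NonZero q}} .{{_ : ℤ.NonZero q′}} → p * q′ ≡ p′ * q → E p q ≈ E p′ q′
  E-cong p q p′ q′ eq = reflexive (cong e (frac-cong p q p′ q′ eq))

  E-integral : ∀ z q .{{_ : ℤ.NonZero q}} → E (z * q) q ≈ 1#
  E-integral z q = ≈-trans (E-cong (z * q) q z 1ℤ (ℤₚ.*-identityʳ (z * q))) (proj₂ (proj₂ e-char) z)

  E-≡ : ∀ {p p′} q → p ≡ p′ → E p q ≈ E p′ q
  E-≡ q refl = ≈-refl

  -- Numerators matter only modulo the denominator; this makes the phase constant on double cosets.
  E-periodic : ∀ m p z q .{{_ : ℤ.NonZero q}} → E (m * (p + z * q)) q ≈ E (m * p) q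
  E-periodic m p z q = begin
    E (m * (p + z * q)) q               ≈⟨ E-≡ q (lemma m p z q) ⟩
    E (m * p + m * z * q) q             ≈⟨ E-+ (m * p) (m * z * q) q ⟩
    E (m * p) q · E (m * z * q) q       ≈⟨ *-congˡ (E-integral (m * z) q) ⟩
    E (m * p) q · 1#                    ≈⟨ *-identityʳ _ ⟩
    E (m * p) q                         ∎
    where
    lemma : ∀ m p z q → m * (p + z * q) ≡ m * p + m * z * q
    lemma = solve-∀

  e-lin : ∀ m p q m′ p′ q′ .{{_ : ℤ.NonZero q}} .{{_ : ℤ.NonZero q′}} →
    e (ℤ→ℚ m ℚ.* frac p q ℚ.+ ℤ→ℚ m′ ℚ.* frac p′ q′) ≈ E (m * p) q · E (m′ * p′) q′
  e-lin m p q m′ p′ q′ = ≈-trans (reflexive (cong e (cong₂ ℚ._+_ (frac-* m p q) (frac-* m′ p′ q′))))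
    (proj₁ e-char (frac (m * p) q) (frac (m′ * p′) q′))

-- The phase of a matrix and its value on words.

module Phase {c ℓ} (R : CommutativeRing c ℓ) (e : ℚ → CommutativeRing.Carrier R) (e-char : IsStdChar R e)
  (m₁ m₂ n₁ n₂ : ℤ) where
  open CommutativeRing R using (Carrier; _≈_; *-cong; *-congˡ; *-congʳ; *-assoc; *-commutativeMonoid; setoid; reflexive)
    renaming (_*_ to _·_; refl to ≈-refl; sym to ≈-sym; trans to ≈-trans)
  open WithChar R e using (ψ)
  open Character R e e-char
  open import Relation.Binary.Reasoning.Setoid setoid

  phase : Mat3 → Carrier
  phase A = ψ m₁ m₂ (uL A) · ψ n₁ n₂ (uR A)

  phaseE : ℤ → ℤ → ℤ → ℤ → ℤ → ℤ → Carrier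
  phaseE D₁ D₂ N a b M = (E (m₁ * N) D₂ · E (m₂ * a) D₁) · (E (n₁ * b) D₁ · E (n₂ * M) D₂)

  phase-E : ∀ A D₁ D₂ .{{_ : ℤ.NonZero D₁}} .{{_ : ℤ.NonZero D₂}} → a31 A ≡ D₁ → minor2 A ≡ D₂ →
    phase A ≈ phaseE D₁ D₂ (N12 A) (a21 A) (a32 A) (m13 A)
  phase-E A _ _ refl refl = *-cong
    (e-lin m₁ (N12 A) (minor2 A) m₂ (a21 A) (a31 A))
    (e-lin n₁ (a32 A) (a31 A) n₂ (m13 A) (minor2 A))

  phase-invariant : ∀ A B D₁ D₂ .{{_ : ℤ.NonZero D₁}} .{{_ : ℤ.NonZero D₂}} → a31 A ≡ D₁ → minor2 A ≡ D₂ →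
    SameDoubleCoset A B → phase B ≈ phase A
  phase-invariant A B D₁ D₂ refl refl A~B =
    let open CosetInvariants (sameDoubleCoset⁻¹ A B A~B) in begin
    phase B                                         ≈⟨ phase-E B D₁ D₂ a31≡ minor2≡ ⟩
    phaseE D₁ D₂ (N12 B) (a21 B) (a32 B) (m13 B)    ≈⟨ *-cong
      (*-cong (≈-trans (E-≡ D₂ (cong (m₁ *_) N12≡)) (E-periodic m₁ (N12 A) v D₂))
              (≈-trans (E-≡ D₁ (cong (m₂ *_) a21≡)) (E-periodic m₂ (a21 A) w D₁)))
      (*-cong (≈-trans (E-≡ D₁ (cong (n₁ *_) a32≡)) (E-periodic n₁ (a32 A) x D₁))
              (≈-trans (E-≡ D₂ (cong (n₂ *_) m13≡)) (E-periodic n₂ (m13 A) z D₂))) ⟩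
    phaseE D₁ D₂ (N12 A) (a21 A) (a32 A) (m13 A)    ≈⟨ phase-E A D₁ D₂ refl refl ⟨
    phase A                                         ∎

  module IndexPhase (d₁ d₂ : ℤ) (f : ℕ) .{{_ : ℤ.NonZero d₁}} .{{_ : ℤ.NonZero d₂}} .{{_ : NonZero f}} where
    open DoubleCosets d₁ d₂ f

    X X′ : ℕ → ℤ
    X  y = m₂ * d₂ + n₂ * d₁ * + y
    X′ x = n₂ * d₁ + m₂ * d₂ * + x

    -- Up to the division of `X y` and `X′ x` by `f`, these are summands of the two classical
    -- Kloosterman sums.
    Φ₁ Φ₂ : ℕ → ℕ × ℕ → Carrier
    Φ₁ y (b , p) = E (n₁ * + b) d₁ · E (+ p * X y) (d₁ * + f)
    Φ₂ x (r , s) = E (m₁ * + r) d₂ · E (+ s * X′ x) (d₂ * + f)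

    Φ : Index → Carrier
    Φ ((x , y) , bp , rs , j) = Φ₁ y bp · (Φ₂ x rs · E (+ j * X′ x) (+ f))

    private
      regroup : ∀ t₁ a c t₂ b d → (t₁ · (a · c)) · (t₂ · (b · d)) ≈ (t₂ · (a · b)) · (t₁ · (c · d))
      regroup = CM.solve 6 (λ t₁ a c t₂ b d → (t₁ ⊕ (a ⊕ c)) ⊕ (t₂ ⊕ (b ⊕ d)) ⊜ (t₂ ⊕ (a ⊕ b)) ⊕ (t₁ ⊕ (c ⊕ d))) ≈-refl
        where
        module CM = CommutativeMonoidSolver *-commutativeMonoid
        open CM using (_⊕_; _⊜_)

      module _ (F : ℤ) .{{_ : ℤ.NonZero F}} where
        instance
          d₁F≢0 : ℤ.NonZero (d₁ * F)
          d₁F≢0 = ℤₚ.i*j≢0 d₁ F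
          d₂F≢0 : ℤ.NonZero (d₂ * F)
          d₂F≢0 = ℤₚ.i*j≢0 d₂ F

        cancel : ∀ m k d .{{_ : ℤ.NonZero d}} .{{_ : ℤ.NonZero (d * F)}} → E (m * (k * F)) (d * F) ≈ E (m * k) d
        cancel m k d = E-cong (m * (k * F)) (d * F) (m * k) d (solve (m ∷ k ∷ F ∷ d ∷ []))

        -- The `S`-term moves to the denominator `d₂F` because `d₁ / (d₁F) = d₂ / (d₂F)`; `split₁₃`
        -- moves the `p`-term the other way. Afterwards `p` occurs only over `d₁F` and `S` only over
        -- `d₂F`.
        split₂₁ : ∀ p S x → E (m₂ * (d₂ * p + S * x * d₁)) (d₁ * F) ≈ E (m₂ * d₂ * p) (d₁ * F) · E (m₂ * d₂ * S * x) (d₂ * F)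
        split₂₁ p S x = begin
          E (m₂ * (d₂ * p + S * x * d₁)) (d₁ * F)                        ≈⟨ E-≡ (d₁ * F) (distrib m₂ d₁ d₂ p S x) ⟩
          E (m₂ * d₂ * p + m₂ * S * x * d₁) (d₁ * F)                     ≈⟨ E-+ (m₂ * d₂ * p) (m₂ * S * x * d₁) (d₁ * F) ⟩
          E (m₂ * d₂ * p) (d₁ * F) · E (m₂ * S * x * d₁) (d₁ * F)        ≈⟨ *-congˡ (E-cong (m₂ * S * x * d₁) (d₁ * F) (m₂ * d₂ * S * x) (d₂ * F) (cross m₂ d₁ d₂ F S x)) ⟩
          E (m₂ * d₂ * p) (d₁ * F) · E (m₂ * d₂ * S * x) (d₂ * F)        ∎
          where
          distrib : ∀ m₂ d₁ d₂ p S x → m₂ * (d₂ * p + S * x * d₁) ≡ m₂ * d₂ * p + m₂ * S * x * d₁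
          distrib = solve-∀
          cross : ∀ m₂ d₁ d₂ F S x → m₂ * S * x * d₁ * (d₂ * F) ≡ m₂ * d₂ * S * x * (d₁ * F)
          cross = solve-∀

        split₁₃ : ∀ p y S → E (n₂ * (d₂ * p * y + S * d₁)) (d₂ * F) ≈ E (n₂ * d₁ * p * y) (d₁ * F) · E (n₂ * d₁ * S) (d₂ * F)
        split₁₃ p y S = begin
          E (n₂ * (d₂ * p * y + S * d₁)) (d₂ * F)                        ≈⟨ E-≡ (d₂ * F) (distrib n₂ d₁ d₂ p y S) ⟩
          E (n₂ * d₂ * p * y + n₂ * d₁ * S) (d₂ * F)                     ≈⟨ E-+ (n₂ * d₂ * p * y) (n₂ * d₁ * S) (d₂ * F) ⟩
          E (n₂ * d₂ * p * y) (d₂ * F) · E (n₂ * d₁ * S) (d₂ * F)        ≈⟨ *-congʳ (E-cong (n₂ * d₂ * p * y) (d₂ * F) (n₂ * d₁ * p * y) (d₁ * F) (cross n₂ d₁ d₂ F p y)) ⟩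
          E (n₂ * d₁ * p * y) (d₁ * F) · E (n₂ * d₁ * S) (d₂ * F)        ∎
          where
          distrib : ∀ n₂ d₁ d₂ p y S → n₂ * (d₂ * p * y + S * d₁) ≡ n₂ * d₂ * p * y + n₂ * d₁ * S
          distrib = solve-∀
          cross : ∀ n₂ d₁ d₂ F p y → n₂ * d₂ * p * y * (d₁ * F) ≡ n₂ * d₁ * p * y * (d₂ * F)
          cross = solve-∀

        join₁ : ∀ p y → E (m₂ * d₂ * p) (d₁ * F) · E (n₂ * d₁ * p * y) (d₁ * F) ≈ E (p * (m₂ * d₂ + n₂ * d₁ * y)) (d₁ * F)
        join₁ p y = ≈-trans (≈-sym (E-+ (m₂ * d₂ * p) (n₂ * d₁ * p * y) (d₁ * F))) (E-≡ (d₁ * F) (lemma m₂ n₂ d₁ d₂ p y))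
          where
          lemma : ∀ m₂ n₂ d₁ d₂ p y → m₂ * d₂ * p + n₂ * d₁ * p * y ≡ p * (m₂ * d₂ + n₂ * d₁ * y)
          lemma = solve-∀

        -- Together the two numerators are `S X′`; in `S = s + d₂j` the second summand cancels `d₂`
        -- and leaves a character modulo `F` in `j`.
        join₂ : ∀ x s j → let X′ = n₂ * d₁ + m₂ * d₂ * x ; S = s + d₂ * j in
          E (m₂ * d₂ * S * x) (d₂ * F) · E (n₂ * d₁ * S) (d₂ * F) ≈ E (s * X′) (d₂ * F) · E (j * X′) F
        join₂ x s j = begin
          E (m₂ * d₂ * S * x) (d₂ * F) · E (n₂ * d₁ * S) (d₂ * F)    ≈⟨ E-+ (m₂ * d₂ * S * x) (n₂ * d₁ * S) (d₂ * F) ⟨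
          E (m₂ * d₂ * S * x + n₂ * d₁ * S) (d₂ * F)                 ≈⟨ E-≡ (d₂ * F) (lemma m₂ n₂ d₁ d₂ x s j) ⟩
          E (s * X₂ + d₂ * j * X₂) (d₂ * F)                          ≈⟨ E-+ (s * X₂) (d₂ * j * X₂) (d₂ * F) ⟩
          E (s * X₂) (d₂ * F) · E (d₂ * j * X₂) (d₂ * F)             ≈⟨ *-congˡ (E-cong (d₂ * j * X₂) (d₂ * F) (j * X₂) F (cross d₂ j X₂ F)) ⟩
          E (s * X₂) (d₂ * F) · E (j * X₂) F                         ∎
          where
          X₂ = n₂ * d₁ + m₂ * d₂ * x
          S = s + d₂ * j
          lemma : ∀ m₂ n₂ d₁ d₂ x s j → m₂ * d₂ * (s + d₂ * j) * x + n₂ * d₁ * (s + d₂ * j) ≡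
                  s * (n₂ * d₁ + m₂ * d₂ * x) + d₂ * j * (n₂ * d₁ + m₂ * d₂ * x)
          lemma = solve-∀
          cross : ∀ d₂ j X F → d₂ * j * X * F ≡ j * X * (d₂ * F)
          cross = solve-∀

        phase-value : ∀ x y b p r s j → let X = m₂ * d₂ + n₂ * d₁ * y ; X′ = n₂ * d₁ + m₂ * d₂ * x ; S = s + d₂ * j in
          phaseE (d₁ * F) (d₂ * F) (r * F) (d₂ * p + S * x * d₁) (b * F) (d₂ * p * y + S * d₁) ≈
          (E (n₁ * b) d₁ · E (p * X) (d₁ * F)) · ((E (m₁ * r) d₂ · E (s * X′) (d₂ * F)) · E (j * X′) F)
        phase-value x y b p r s j = begin
          phaseE (d₁ * F) (d₂ * F) (r * F) (d₂ * p + S * x * d₁) (b * F) (d₂ * p * y + S * d₁)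
            ≈⟨ *-cong (*-cong (cancel m₁ r d₂) (split₂₁ p S x)) (*-cong (cancel n₁ b d₁) (split₁₃ p y S)) ⟩
          (E (m₁ * r) d₂ · (E (m₂ * d₂ * p) (d₁ * F) · E (m₂ * d₂ * S * x) (d₂ * F)))
            · (E (n₁ * b) d₁ · (E (n₂ * d₁ * p * y) (d₁ * F) · E (n₂ * d₁ * S) (d₂ * F)))
            ≈⟨ regroup _ _ _ _ _ _ ⟩
          (E (n₁ * b) d₁ · (E (m₂ * d₂ * p) (d₁ * F) · E (n₂ * d₁ * p * y) (d₁ * F)))
            · (E (m₁ * r) d₂ · (E (m₂ * d₂ * S * x) (d₂ * F) · E (n₂ * d₁ * S) (d₂ * F)))
            ≈⟨ *-cong (*-congˡ (join₁ p y)) (*-congˡ (join₂ x s j)) ⟩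
          (E (n₁ * b) d₁ · E (p * X₁) (d₁ * F)) · (E (m₁ * r) d₂ · (E (s * X₂) (d₂ * F) · E (j * X₂) F))
            ≈⟨ *-congˡ (*-assoc _ _ _) ⟨
          (E (n₁ * b) d₁ · E (p * X₁) (d₁ * F)) · ((E (m₁ * r) d₂ · E (s * X₂) (d₂ * F)) · E (j * X₂) F)  ∎
          where
          S = s + d₂ * j
          X₁ = m₂ * d₂ + n₂ * d₁ * y
          X₂ = n₂ * d₁ + m₂ * d₂ * x

    phase-word : ∀ J valid → phase (word J valid) ≈ Φ J
    phase-word J@((x , y) , (b , p) , (r , s) , j) valid = begin
      phase A                                                            ≈⟨ phase-E A (d₁ * + f) (d₂ * + f) {{d₁F≢0 (+ f)}} {{d₂F≢0 (+ f)}} refl (minor2-word J valid) ⟩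
      phaseE (d₁ * + f) (d₂ * + f) (N12 A) (a21 A) (a32 A) (m13 A)       ≈⟨ reflexive (cong₂ (λ N M → phaseE (d₁ * + f) (d₂ * + f) N (a21 A) (a32 A) M) (N12-word J valid) (m13-word J valid)) ⟩
      phaseE (d₁ * + f) (d₂ * + f) (+ r * + f) (a21 A) (a32 A) (d₂ * + p * + y + (+ s + d₂ * + j) * d₁)  ≈⟨ phase-value (+ f) (+ x) (+ y) (+ b) (+ p) (+ r) (+ s) (+ j) ⟩
      Φ J ∎
      where A = word J valid

-- Lists of inverse pairs and sums over lists.

-- The test is literally the one in `Kl` and `RHS`, so one decision governs both the filter and the
-- summand.
inverse? : ∀ n → Decidable (λ ((a , d) : ℕ × ℕ) → n ℕD.∣ ∣ + a * + d - 1ℤ ∣)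
inverse? n (a , d) = n ℕD.∣? ∣ + a * + d - 1ℤ ∣

inversePairs : ℕ → List (ℕ × ℕ)
inversePairs n = filter (inverse? n) (cartesianProduct (downFrom n) (downFrom n))

inversePairs-unique : ∀ n → Unique (inversePairs n)
inversePairs-unique n = Unique.filter⁺ (inverse? n) (Unique.cartesianProduct⁺ (Unique.downFrom⁺ n) (Unique.downFrom⁺ n))

∈-inversePairs⁺ : ∀ {c a d} → InversePair c a d → (a , d) ∈ inversePairs ∣ c ∣
∈-inversePairs⁺ {c} (inversePair a<c d<c k ad≡) = ∈-filter⁺ (inverse? ∣ c ∣)
  (∈-cartesianProduct⁺ (∈-downFrom⁺ a<c) (∈-downFrom⁺ d<c)) (∣⇒∣ᵤ (divides k ad≡))

∈-inversePairs⁻ : ∀ c {a d} → (a , d) ∈ inversePairs ∣ c ∣ → InversePair c a d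
∈-inversePairs⁻ c ad∈ =
  let ad∈× , c∣ad-1 = ∈-filter⁻ (inverse? ∣ c ∣) ad∈
      a∈ , d∈ = ∈-cartesianProduct⁻ (downFrom ∣ c ∣) (downFrom ∣ c ∣) ad∈×
      divides k ad≡ = ∣ᵤ⇒∣ {c} c∣ad-1
  in inversePair (∈-downFrom⁻ a∈) (∈-downFrom⁻ d∈) k ad≡

module Sums {r ℓ} (R : CommutativeRing r ℓ) where
  open CommutativeRing R using (Carrier; _≈_; 0#; +-cong; +-congˡ; +-identityˡ; +-assoc;
      distribˡ; distribʳ; zeroˡ; zeroʳ; setoid; isEquivalence; +-isCommutativeMonoid)
    renaming (_+_ to _⊕_; _*_ to _·_; refl to ≈-refl; sym to ≈-sym; trans to ≈-trans)

  sumL : ∀ {A : Set} → List A → (A → Carrier) → Carrier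
  sumL xs g = foldr _⊕_ 0# (map g xs)

  module _ {A : Set} where
    sumL-cong : ∀ (xs : List A) {g h} → (∀ {x} → x ∈ xs → g x ≈ h x) → sumL xs g ≈ sumL xs h
    sumL-cong []       g≈h = ≈-refl
    sumL-cong (x ∷ xs) g≈h = +-cong (g≈h (here refl)) (sumL-cong xs (λ x∈ → g≈h (there x∈)))

    sumL-zero : ∀ (xs : List A) {g} → (∀ {x} → x ∈ xs → g x ≈ 0#) → sumL xs g ≈ 0#
    sumL-zero []       g≈0 = ≈-refl
    sumL-zero (x ∷ xs) g≈0 = ≈-trans (+-cong (g≈0 (here refl)) (sumL-zero xs (λ x∈ → g≈0 (there x∈)))) (+-identityˡ 0#)

    sumL-++ : ∀ (xs ys : List A) g → sumL (xs ++ ys) g ≈ sumL xs g ⊕ sumL ys g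
    sumL-++ []       ys g = ≈-sym (+-identityˡ _)
    sumL-++ (x ∷ xs) ys g = ≈-trans (+-congˡ (sumL-++ xs ys g)) (≈-sym (+-assoc _ _ _))

    sumL-·ˡ : ∀ (xs : List A) a g → sumL xs (λ x → a · g x) ≈ a · sumL xs g
    sumL-·ˡ []       a g = ≈-sym (zeroʳ a)
    sumL-·ˡ (x ∷ xs) a g = ≈-trans (+-congˡ (sumL-·ˡ xs a g)) (≈-sym (distribˡ a _ _))

    sumL-·ʳ : ∀ (xs : List A) a g → sumL xs (λ x → g x · a) ≈ sumL xs g · a
    sumL-·ʳ []       a g = ≈-sym (zeroˡ a)
    sumL-·ʳ (x ∷ xs) a g = ≈-trans (+-congˡ (sumL-·ʳ xs a g)) (≈-sym (distribʳ a _ _))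

    sumL-filter : ∀ {p} {P : Pred A p} (P? : Decidable P) xs g →
      sumL (filter P? xs) g ≈ sumL xs (λ x → if does (P? x) then g x else 0#)
    sumL-filter P? []       g = ≈-refl
    sumL-filter P? (x ∷ xs) g with P? x
    ... | yes _ = +-congˡ (sumL-filter P? xs g)
    ... | no  _ = ≈-trans (sumL-filter P? xs g) (≈-sym (+-identityˡ _))

    sumL-↭ : ∀ {xs ys : List A} g → xs ↭ ys → sumL xs g ≈ sumL ys g
    sumL-↭ g xs↭ys = Permutationₛ.foldr-commMonoid setoid +-isCommutativeMonoid (↭⇒↭ₛ′ isEquivalence (map⁺ g xs↭ys))

    sumL-map : ∀ {B : Set} (h : B → A) (ys : List B) g → sumL (map h ys) g ≡ sumL ys (λ y → g (h y))
    sumL-map h ys g = cong (foldr _⊕_ 0#) (sym (Listₚ.map-∘ ys))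

  sumL-cartesianProduct : ∀ {A B : Set} (xs : List A) (ys : List B) g →
    sumL (cartesianProduct xs ys) g ≈ sumL xs (λ x → sumL ys (λ y → g (x , y)))
  sumL-cartesianProduct []       ys g = ≈-refl
  sumL-cartesianProduct (x ∷ xs) ys g = begin
    sumL (map (x ,_) ys ++ cartesianProduct xs ys) g               ≈⟨ sumL-++ (map (x ,_) ys) (cartesianProduct xs ys) g ⟩
    sumL (map (x ,_) ys) g ⊕ sumL (cartesianProduct xs ys) g       ≡⟨ cong (_⊕ sumL (cartesianProduct xs ys) g) (sumL-map (x ,_) ys g) ⟩
    sumL ys (λ y → g (x , y)) ⊕ sumL (cartesianProduct xs ys) g    ≈⟨ +-congˡ (sumL-cartesianProduct xs ys g) ⟩
    sumL ys (λ y → g (x , y)) ⊕ sumL xs (λ x → sumL ys (λ y → g (x , y)))  ∎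
    where open import Relation.Binary.Reasoning.Setoid setoid

  sumL-product : ∀ {A B : Set} (xs : List A) (ys : List B) g h →
    sumL xs (λ x → sumL ys (λ y → g x · h y)) ≈ sumL xs g · sumL ys h
  sumL-product xs ys g h = ≈-trans (sumL-cong xs (λ {x} _ → sumL-·ˡ ys (g x) h)) (sumL-·ʳ xs (sumL ys h) g)

  sumL-cartesianProduct-· : ∀ {A B : Set} (xs : List A) (ys : List B) g h →
    sumL (cartesianProduct xs ys) (λ (x , y) → g x · h y) ≈ sumL xs g · sumL ys h
  sumL-cartesianProduct-· xs ys g h = ≈-trans (sumL-cartesianProduct xs ys _) (sumL-product xs ys g h)

-- Classical Kloosterman sums as list sums, and orthogonality.

module CharSums {r ℓ} (R : CommutativeRing r ℓ) (e : ℚ → CommutativeRing.Carrier R) (e-char : IsStdChar R e) where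
  open CommutativeRing R using (Carrier; _≈_; 0#; 1#; +-cong; +-congˡ; +-congʳ; +-comm; -‿inverseʳ; -‿cong;
      *-identityˡ; distribˡ; zeroʳ; setoid; ring; +-commutativeSemigroup)
    renaming (_+_ to _⊕_; _*_ to _·_; _-_ to _⊖_; refl to ≈-refl; sym to ≈-sym; trans to ≈-trans)
  open WithChar R e
  open Sums R
  open Character R e e-char
  open import Relation.Binary.Reasoning.Setoid setoid
  open RingProperties ring using ([y-z]x≈yx-zx; +-cancelʳ; x∙y⁻¹≈ε⇒x≈y)

  sumR-cong : ∀ n {g h} → (∀ i → g i ≈ h i) → sumR n g ≈ sumR n h
  sumR-cong zero    g≈h = ≈-refl
  sumR-cong (suc n) g≈h = +-cong (sumR-cong n g≈h) (g≈h n)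

  sumR≈sumL : ∀ n g → sumR n g ≈ sumL (downFrom n) g
  sumR≈sumL zero    g = ≈-refl
  sumR≈sumL (suc n) g = ≈-trans (+-comm _ _) (+-congˡ (sumR≈sumL n g))

  sumFin≈sumL : ∀ {A : Set} k (h : Fin k → A) g → sumFin k (λ i → g (h i)) ≈ sumL (tabulate h) g
  sumFin≈sumL zero    h g = ≈-refl
  sumFin≈sumL (suc k) h g = +-congˡ (sumFin≈sumL k (λ i → h (Fin.suc i)) g)

  sumR-inversePairs : ∀ n g → sumR n (λ a → sumR n (λ d → if does (inverse? n (a , d)) then g (a , d) else 0#)) ≈ sumL (inversePairs n) g
  sumR-inversePairs n g = begin
    sumR n (λ a → sumR n (λ d → g′ (a , d)))                          ≈⟨ sumR-cong n (λ a → sumR≈sumL n (λ d → g′ (a , d))) ⟩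
    sumR n (λ a → sumL (downFrom n) (λ d → g′ (a , d)))               ≈⟨ sumR≈sumL n _ ⟩
    sumL (downFrom n) (λ a → sumL (downFrom n) (λ d → g′ (a , d)))    ≈⟨ sumL-cartesianProduct (downFrom n) (downFrom n) g′ ⟨
    sumL (cartesianProduct (downFrom n) (downFrom n)) g′              ≈⟨ sumL-filter (inverse? n) (cartesianProduct (downFrom n) (downFrom n)) g ⟨
    sumL (inversePairs n) g                                           ∎
    where
    g′ : ℕ × ℕ → Carrier
    g′ ad = if does (inverse? n ad) then g ad else 0#

  module _ (m n c : ℤ) where
    private
      -- The case distinction in Kl is a local function of its definition; unification recovers the summand.
      Kl-summand : ∃ λ (H : ℕ → ℕ → Carrier) → Kl m n c ≡ sumR ∣ c ∣ (λ a → sumR ∣ c ∣ (H a))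
      Kl-summand = _ , refl

      Kl-summand≈ : ∀ a d → proj₁ Kl-summand a d ≈ (if does (inverse? ∣ c ∣ (a , d)) then E (m * + a + n * + d) c else 0#)
      Kl-summand≈ a d with inverse? ∣ c ∣ (a , d)
      ... | yes _ = ≈-refl
      ... | no _  = ≈-refl

    Kl≈sumL : Kl m n c ≈ sumL (inversePairs ∣ c ∣) (λ (a , d) → E (m * + a + n * + d) c)
    Kl≈sumL = ≈-trans (sumR-cong ∣ c ∣ (λ a → sumR-cong ∣ c ∣ (Kl-summand≈ a))) (sumR-inversePairs ∣ c ∣ _)

  sumR-one : ∀ n {g} → (∀ i → g i ≈ 1#) → sumR n g ≈ natR n
  sumR-one zero    g≈1 = ≈-refl
  sumR-one (suc n) g≈1 = ≈-trans (+-comm _ _) (+-cong (g≈1 n) (sumR-one n g≈1))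

  sumR-·ˡ : ∀ n a g → sumR n (λ i → a · g i) ≈ a · sumR n g
  sumR-·ˡ zero    a g = ≈-sym (zeroʳ a)
  sumR-·ˡ (suc n) a g = ≈-trans (+-congʳ (sumR-·ˡ n a g)) (≈-sym (distribˡ a _ _))

  sumR-suc : ∀ n g → sumR n (λ i → g (suc i)) ⊕ g 0 ≈ sumR n g ⊕ g n
  sumR-suc zero    g = ≈-refl
  sumR-suc (suc n) g = begin
    (sumR n (λ i → g (suc i)) ⊕ g (suc n)) ⊕ g 0   ≈⟨ xy∙z≈xz∙y _ _ _ ⟩
    (sumR n (λ i → g (suc i)) ⊕ g 0) ⊕ g (suc n)   ≈⟨ +-congʳ (sumR-suc n g) ⟩
    (sumR n g ⊕ g n) ⊕ g (suc n)                   ∎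
    where open CommutativeSemigroupProperties +-commutativeSemigroup using (xy∙z≈xz∙y)

  module _ (f : ℕ) .{{_ : NonZero f}} (X : ℤ) where

    orthogonality-∣ : + f ∣ℤ X → sumR f (λ j → E (+ j * X) (+ f)) ≈ natR f
    orthogonality-∣ (divides q X≡) = sumR-one f λ j →
      ≈-trans (E-≡ (+ f) (trans (cong (+ j *_) X≡) (sym (ℤₚ.*-assoc (+ j) q (+ f))))) (E-integral (+ j * q) (+ f))

    -- ω = e(X/f) ≠ 1 satisfies ω T = T for the sum T, so T = 0 in a domain.
    orthogonality-∤ : IsDomain R → ¬ (+ f ∣ℤ X) → sumR f (λ j → E (+ j * X) (+ f)) ≈ 0#
    orthogonality-∤ domain f∤X = T≈0 (domain (ω ⊖ 1#) T [ω-1]T≈0)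
      where
      ω T : Carrier
      ω = E X (+ f)
      T = sumR f (λ j → E (+ j * X) (+ f))
      shifted : ∀ j → E (+ suc j * X) (+ f) ≈ ω · E (+ j * X) (+ f)
      shifted j = ≈-trans (E-≡ (+ f) (ℤₚ.suc-* (+ j) X)) (E-+ X (+ j * X) (+ f))
      ωT≈T : ω · T ≈ T
      ωT≈T = +-cancelʳ (E (+ 0 * X) (+ f)) (ω · T) T (begin
        ω · T ⊕ E (+ 0 * X) (+ f)                                   ≈⟨ +-congʳ (sumR-·ˡ f ω _) ⟨
        sumR f (λ j → ω · E (+ j * X) (+ f)) ⊕ E (+ 0 * X) (+ f)    ≈⟨ +-congʳ (sumR-cong f shifted) ⟨
        sumR f (λ j → E (+ suc j * X) (+ f)) ⊕ E (+ 0 * X) (+ f)    ≈⟨ sumR-suc f _ ⟩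
        -- The shift trades the term at 0 for the term at `f`; both are 1 and cancel.
        T ⊕ E (+ f * X) (+ f)                                       ≈⟨ +-congˡ (≈-trans (E-≡ (+ f) (ℤₚ.*-comm (+ f) X)) (E-integral X (+ f))) ⟩
        T ⊕ 1#                                                      ≈⟨ +-congˡ (E-integral 0ℤ (+ f)) ⟨
        T ⊕ E (0ℤ * + f) (+ f)                                      ≡⟨⟩
        T ⊕ E (+ 0 * X) (+ f)                                       ∎)
      [ω-1]T≈0 : (ω ⊖ 1#) · T ≈ 0#
      [ω-1]T≈0 = begin
        (ω ⊖ 1#) · T      ≈⟨ [y-z]x≈yx-zx T ω 1# ⟩
        ω · T ⊖ 1# · T    ≈⟨ +-cong ωT≈T (-‿cong (*-identityˡ T)) ⟩
        T ⊖ T             ≈⟨ -‿inverseʳ T ⟩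
        0#                ∎
      T≈0 : ω ⊖ 1# ≈ 0# ⊎ T ≈ 0# → T ≈ 0#
      T≈0 (inj₂ T≈0)   = T≈0
      T≈0 (inj₁ ω-1≈0) =
        -- The kernel of `e` consists of integers, so `ω = 1` would make `X / f` integral.
        let z , X/f≡z = proj₁ (proj₂ e-char) (frac X (+ f)) (x∙y⁻¹≈ε⇒x≈y ω 1# ω-1≈0)
        in contradiction (divides z (frac-integral X f z X/f≡z)) f∤X

-- Divisibility by `f` and the gcd criterion.

/ℕ-exact : ∀ z f .{{_ : NonZero f}} → + f ∣ℤ z → z ≡ (z /ℕ f) * + f
/ℕ-exact z f (divides q z≡) = begin
  z                                   ≡⟨ a≡a%ℕn+[a/ℕn]*n z f ⟩
  + (z %ℕ f) + (z /ℕ f) * + f         ≡⟨ cong (λ r → + r + (z /ℕ f) * + f) r≡0 ⟩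
  0ℤ + (z /ℕ f) * + f                 ≡⟨ ℤₚ.+-identityˡ _ ⟩
  (z /ℕ f) * + f                      ∎
  where
  open ≡-Reasoning
  lemma : ∀ r w q F → q * F ≡ r + w * F → r ≡ 0ℤ + (q - w) * F
  lemma r w q F h = lin₁ (- 1ℤ) h (solve (r ∷ w ∷ q ∷ F ∷ []))
  r≡0 : z %ℕ f ≡ 0
  r≡0 = residue-unique (+ f) (q - z /ℕ f) (n%ℕd<d z f) (ℕ.>-nonZero⁻¹ f)
          (lemma (+ (z %ℕ f)) (z /ℕ f) q (+ f) (trans (sym z≡) (a≡a%ℕn+[a/ℕn]*n z f)))

-- `c + ax = x(a + cy) - c(xy - 1)`: multiplication by the unit `x` turns one congruence into the
-- other.
twisted-∣ : ∀ F a c x y k → x * y - 1ℤ ≡ k * F → F ∣ℤ a + c * y → F ∣ℤ c + a * x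
twisted-∣ F a c x y k h (divides q h′) = divides (x * q - c * k) (lemma F a c x y k q h h′)
  where
  lemma : ∀ F a c x y k q → x * y - 1ℤ ≡ k * F → a + c * y ≡ q * F → c + a * x ≡ (x * q - c * k) * F
  lemma F a c x y k q h h′ = lin₂ (- c) h x h′ (solve (F ∷ a ∷ c ∷ x ∷ y ∷ k ∷ q ∷ []))

-- The gcd of `a` and `f` divides `c + ax`, because `f` does, and it divides `ax`; hence it divides
-- `c`.
gcd-∣-gcd : ∀ f a c x y k → x * y - 1ℤ ≡ k * + f → + f ∣ℤ a + c * y → gcd (∣ a ∣) f ℕD.∣ gcd (∣ c ∣) f
gcd-∣-gcd f a c x y k h f∣ = gcd-greatest (∣⇒∣ᵤ {+ g} {c} g∣c) (gcd[m,n]∣n (∣ a ∣) f)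
  where
  g = gcd (∣ a ∣) f
  lemma : ∀ c d → c + d - d ≡ c
  lemma = solve-∀
  g∣c : + g ∣ℤ c
  g∣c = subst (+ g ∣ℤ_) (lemma c (a * x))
    (∣m∣n⇒∣m-n (∣-trans (∣ᵤ⇒∣ {+ g} {+ f} (gcd[m,n]∣n (∣ a ∣) f)) (twisted-∣ (+ f) a c x y k h f∣))
               (∣m⇒∣m*n x (∣ᵤ⇒∣ {+ g} {a} (gcd[m,n]∣m (∣ a ∣) f))))

gcd-≡ : ∀ f a c {x y} → InversePair (+ f) x y → + f ∣ℤ a + c * + y → gcd (∣ a ∣) f ≡ gcd (∣ c ∣) f
gcd-≡ f a c {x} {y} pair@(inversePair _ _ k h) f∣ = ℕD.∣-antisym
  (gcd-∣-gcd f a c (+ x) (+ y) k h f∣)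
  (gcd-∣-gcd f c a (+ y) (+ x) k (InversePair.ad≡ (InversePair-sym pair)) (twisted-∣ (+ f) a c (+ x) (+ y) k h f∣))

-- The sum over all indices, and its transfer to arbitrary representatives.

module Evaluation {c ℓ} (R : CommutativeRing c ℓ) (domain : IsDomain R) (e : ℚ → CommutativeRing.Carrier R) (e-char : IsStdChar R e)
  (d₁ d₂ : ℤ) (f : ℕ) .{{_ : ℤ.NonZero d₁}} .{{_ : ℤ.NonZero d₂}} .{{_ : NonZero f}} (m₁ m₂ n₁ n₂ : ℤ) where
  open CommutativeRing R using (Carrier; _≈_; 0#; *-cong; *-congˡ; zeroʳ; *-comm; *-assoc; setoid; reflexive)
    renaming (_*_ to _·_; refl to ≈-refl; sym to ≈-sym; trans to ≈-trans)
  open WithChar R e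
  open Character R e e-char
  open Phase R e e-char m₁ m₂ n₁ n₂
  open IndexPhase d₁ d₂ f
  open Sums R
  open CharSums R e e-char
  open DoubleCosets d₁ d₂ f
  open import Relation.Binary.Reasoning.Setoid setoid

  KlProduct : ℕ × ℕ → Carrier
  KlProduct (x , y) = Kl n₁ (X y /ℕ f) d₁ · Kl m₁ (X′ x /ℕ f) d₂

  RHSTerm : ℕ × ℕ → Carrier
  RHSTerm (x , y) = if does (f ℕD.∣? ∣ X y ∣) then KlProduct (x , y) else 0#

  private
    RHS-summand : ∃ λ (H : ℕ → ℕ → Carrier) → RHS m₁ m₂ n₁ n₂ d₁ d₂ f ≡ natR f · sumR f (λ x → sumR f (H x))
    RHS-summand = _ , refl

    RHS-summand≈ : ∀ x y → proj₁ RHS-summand x y ≈ (if does (inverse? f (x , y)) then RHSTerm (x , y) else 0#)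
    RHS-summand≈ x y with inverse? f (x , y) | f ℕD.∣? ∣ X y ∣
    ... | yes _ | yes _ = ≈-refl
    ... | yes _ | no  _ = ≈-refl
    ... | no  _ | _     = ≈-refl

  RHS≈sumL : RHS m₁ m₂ n₁ n₂ d₁ d₂ f ≈ natR f · sumL (inversePairs f) RHSTerm
  RHS≈sumL = *-congˡ (≈-trans (sumR-cong f (λ x → sumR-cong f (RHS-summand≈ x))) (sumR-inversePairs f RHSTerm))

  RHSTerm-∣ : ∀ x y → + f ∣ℤ X y → RHSTerm (x , y) ≡ KlProduct (x , y)
  RHSTerm-∣ x y f∣X = cong (λ b → if b then KlProduct (x , y) else 0#) (dec-true (f ℕD.∣? ∣ X y ∣) (∣⇒∣ᵤ {+ f} {X y} f∣X))

  RHSTerm-∤ : ∀ x y → ¬ (+ f ∣ℤ X y) → RHSTerm (x , y) ≡ 0#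
  RHSTerm-∤ x y f∤X = cong (λ b → if b then KlProduct (x , y) else 0#) (dec-false (f ℕD.∣? ∣ X y ∣) (λ f∣X → f∤X (∣ᵤ⇒∣ {+ f} {X y} f∣X)))

  -- A single inverse pair with `f` dividing `X y` would force the two gcds to agree.
  RHS≈0 : ¬ (gcd (∣ m₂ * d₂ ∣) f ≡ gcd (∣ n₂ * d₁ ∣) f) → RHS m₁ m₂ n₁ n₂ d₁ d₂ f ≈ 0#
  RHS≈0 gcd≢ = ≈-trans RHS≈sumL (≈-trans (*-congˡ (sumL-zero (inversePairs f) term≈0)) (zeroʳ _))
    where
    term≈0 : ∀ {xy} → xy ∈ inversePairs f → RHSTerm xy ≈ 0#
    term≈0 {x , y} xy∈ = reflexive (RHSTerm-∤ x y (λ f∣X → gcd≢ (gcd-≡ f (m₂ * d₂) (n₂ * d₁) (∈-inversePairs⁻ (+ f) xy∈) f∣X)))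

  -- Once `f` divides `Z` it cancels from the fraction, and the two factors merge into one summand
  -- of a classical Kloosterman sum modulo `d`.
  E-combine : ∀ d a p N Z .{{_ : ℤ.NonZero d}} → Z ≡ N * + f → E a d · E (p * Z) (d * + f) ≈ E (a + N * p) d
  E-combine d a p N _ refl = ≈-trans
    (*-congˡ (E-cong (p * (N * + f)) (d * + f) (N * p) d {{ℤₚ.i*j≢0 d (+ f)}} (lemma p N (+ f) d)))
    (≈-sym (E-+ a (N * p) d))
    where
    lemma : ∀ p N F d → p * (N * F) * d ≡ N * p * (d * F)
    lemma = solve-∀

  sum-j : ℕ → Carrier
  sum-j x = sumL (downFrom f) (λ j → E (+ j * X′ x) (+ f))

  module _ {x y : ℕ} (pair : InversePair (+ f) x y) where
    private
      ΣΦ₁ ΣΦ₂ Kl₁ Kl₂ : Carrier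
      ΣΦ₁ = sumL (inversePairs ∣ d₁ ∣) (Φ₁ y)
      ΣΦ₂ = sumL (inversePairs ∣ d₂ ∣) (Φ₂ x)
      Kl₁ = Kl n₁ (X y /ℕ f) d₁
      Kl₂ = Kl m₁ (X′ x /ℕ f) d₂

    term-∣ : + f ∣ℤ X y → ΣΦ₁ · (ΣΦ₂ · sum-j x) ≈ natR f · RHSTerm (x , y)
    term-∣ f∣X = begin
      ΣΦ₁ · (ΣΦ₂ · sum-j x)       ≈⟨ *-cong ΣΦ₁≈ (*-cong ΣΦ₂≈ sum-j≈) ⟩
      Kl₁ · (Kl₂ · natR f)        ≈⟨ *-assoc Kl₁ Kl₂ (natR f) ⟨
      (Kl₁ · Kl₂) · natR f        ≈⟨ *-comm (Kl₁ · Kl₂) (natR f) ⟩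
      natR f · (Kl₁ · Kl₂)        ≡⟨ cong (natR f ·_) (RHSTerm-∣ x y f∣X) ⟨
      natR f · RHSTerm (x , y)    ∎
      where
      f∣X′ : + f ∣ℤ X′ x
      f∣X′ = twisted-∣ (+ f) (m₂ * d₂) (n₂ * d₁) (+ x) (+ y) (InversePair.k pair) (InversePair.ad≡ pair) f∣X
      sum-j≈ : sum-j x ≈ natR f
      sum-j≈ = ≈-trans (≈-sym (sumR≈sumL f _)) (orthogonality-∣ f (X′ x) f∣X′)
      ΣΦ₁≈ : ΣΦ₁ ≈ Kl₁
      ΣΦ₁≈ = ≈-trans
        (sumL-cong (inversePairs ∣ d₁ ∣) λ {bp} _ → E-combine d₁ (n₁ * + proj₁ bp) (+ proj₂ bp) (X y /ℕ f) (X y) (/ℕ-exact (X y) f f∣X))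
        (≈-sym (Kl≈sumL n₁ (X y /ℕ f) d₁))
      ΣΦ₂≈ : ΣΦ₂ ≈ Kl₂
      ΣΦ₂≈ = ≈-trans
        (sumL-cong (inversePairs ∣ d₂ ∣) λ {rs} _ → E-combine d₂ (m₁ * + proj₁ rs) (+ proj₂ rs) (X′ x /ℕ f) (X′ x) (/ℕ-exact (X′ x) f f∣X′))
        (≈-sym (Kl≈sumL m₁ (X′ x /ℕ f) d₂))

    term-∤ : ¬ (+ f ∣ℤ X y) → ΣΦ₁ · (ΣΦ₂ · sum-j x) ≈ natR f · RHSTerm (x , y)
    term-∤ f∤X = begin
      ΣΦ₁ · (ΣΦ₂ · sum-j x)       ≈⟨ *-congˡ (*-congˡ sum-j≈0) ⟩
      ΣΦ₁ · (ΣΦ₂ · 0#)            ≈⟨ *-congˡ (zeroʳ ΣΦ₂) ⟩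
      ΣΦ₁ · 0#                    ≈⟨ zeroʳ ΣΦ₁ ⟩
      0#                          ≈⟨ zeroʳ (natR f) ⟨
      natR f · 0#                 ≡⟨ cong (natR f ·_) (RHSTerm-∤ x y f∤X) ⟨
      natR f · RHSTerm (x , y)    ∎
      where
      -- The sum over `j` detects `X′` while the right-hand side tests `X`; the twist by the pair
      -- with its roles exchanged links the two.
      f∤X′ : ¬ (+ f ∣ℤ X′ x)
      f∤X′ f∣X′ = f∤X (twisted-∣ (+ f) (n₂ * d₁) (m₂ * d₂) (+ y) (+ x) (InversePair.k pair) (InversePair.ad≡ (InversePair-sym pair)) f∣X′)
      sum-j≈0 : sum-j x ≈ 0#
      sum-j≈0 = ≈-trans (≈-sym (sumR≈sumL f _)) (orthogonality-∤ f (X′ x) domain f∤X′)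

    term-value : ΣΦ₁ · (ΣΦ₂ · sum-j x) ≈ natR f · RHSTerm (x , y)
    term-value = fromDec (+ f ∣ℤ? X y)
      where
      fromDec : Dec (+ f ∣ℤ X y) → ΣΦ₁ · (ΣΦ₂ · sum-j x) ≈ natR f · RHSTerm (x , y)
      fromDec (yes f∣X) = term-∣ f∣X
      fromDec (no  f∤X) = term-∤ f∤X

  -- `(x , y)` stays outermost: for a fixed pair the sum over the remaining residues factors into
  -- three.
  tails : List ((ℕ × ℕ) × (ℕ × ℕ) × ℕ)
  tails = cartesianProduct (inversePairs ∣ d₁ ∣) (cartesianProduct (inversePairs ∣ d₂ ∣) (downFrom f))

  indices : List Index
  indices = cartesianProduct (inversePairs f) tails

  indices-unique : Unique indices
  indices-unique = Unique.cartesianProduct⁺ (inversePairs-unique f) (Unique.cartesianProduct⁺ (inversePairs-unique ∣ d₁ ∣)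
    (Unique.cartesianProduct⁺ (inversePairs-unique ∣ d₂ ∣) (Unique.downFrom⁺ f)))

  ∈-indices⁺ : ∀ {J} → IsIndex J → J ∈ indices
  ∈-indices⁺ (P , Q , S , j<f) = ∈-cartesianProduct⁺ (∈-inversePairs⁺ P) (∈-cartesianProduct⁺ (∈-inversePairs⁺ Q)
    (∈-cartesianProduct⁺ (∈-inversePairs⁺ S) (∈-downFrom⁺ j<f)))

  ∈-indices⁻ : ∀ {J} → J ∈ indices → IsIndex J
  ∈-indices⁻ J∈ =
    let P , J∈′ = ∈-cartesianProduct⁻ (inversePairs f) tails J∈
        Q , J∈″ = ∈-cartesianProduct⁻ (inversePairs ∣ d₁ ∣) (cartesianProduct (inversePairs ∣ d₂ ∣) (downFrom f)) J∈′
        S , j∈  = ∈-cartesianProduct⁻ (inversePairs ∣ d₂ ∣) (downFrom f) J∈″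
    in ∈-inversePairs⁻ (+ f) P , ∈-inversePairs⁻ d₁ Q , ∈-inversePairs⁻ d₂ S , ∈-downFrom⁻ j∈

  sum-indices : sumL indices Φ ≈ RHS m₁ m₂ n₁ n₂ d₁ d₂ f
  sum-indices = begin
    sumL indices Φ                                          ≈⟨ sumL-cartesianProduct (inversePairs f) tails Φ ⟩
    sumL (inversePairs f) (λ xy → sumL tails (λ τ → Φ (xy , τ)))
      ≈⟨ sumL-cong (inversePairs f) (λ {xy} xy∈ → ≈-trans (factor xy) (term-value (∈-inversePairs⁻ (+ f) xy∈))) ⟩
    sumL (inversePairs f) (λ xy → natR f · RHSTerm xy)      ≈⟨ sumL-·ˡ (inversePairs f) (natR f) RHSTerm ⟩
    natR f · sumL (inversePairs f) RHSTerm                  ≈⟨ RHS≈sumL ⟨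
    RHS m₁ m₂ n₁ n₂ d₁ d₂ f                                 ∎
    where
    factor : ∀ ((x , y) : ℕ × ℕ) → sumL tails (λ τ → Φ ((x , y) , τ))
      ≈ sumL (inversePairs ∣ d₁ ∣) (Φ₁ y) · (sumL (inversePairs ∣ d₂ ∣) (Φ₂ x) · sum-j x)
    factor (x , y) = ≈-trans (sumL-cartesianProduct-· (inversePairs ∣ d₁ ∣) _ (Φ₁ y) (λ (rs , j) → Φ₂ x rs · E (+ j * X′ x) (+ f)))
      (*-congˡ (sumL-cartesianProduct-· (inversePairs ∣ d₂ ∣) (downFrom f) (Φ₂ x) (λ j → E (+ j * X′ x) (+ f))))

  -- The index of each representative is a parameter, so the bijection rests on `IsIndex` and
  -- `HasIndex` and not on how the index was found.
  module Reindexing (k : ℕ) (reps : Fin k → Mat3) (isReps : IsDoubleCosetReps d₁ d₂ f k reps)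
    (index : Fin k → Index) (isIndex : ∀ i → IsIndex (index i)) (hasIndex : ∀ i → HasIndex (reps i) (index i)) where
    private
      reps∈Ω : ∀ i → InΩ d₁ d₂ f (reps i)
      reps∈Ω = proj₁ isReps

    reps~word : ∀ i J (valid : IsIndex J) → HasIndex (reps i) J → SameDoubleCoset (reps i) (word J valid)
    reps~word i J valid = hasIndex⇒sameDoubleCoset J valid (reps i) (reps∈Ω i)

    -- Two representatives with one index lie in the double coset of the same word, which has a
    -- single representative.
    index-injective : ∀ {i j} → index i ≡ index j → i ≡ j
    index-injective {i} {j} eq =
      let _ , _ , unique = proj₂ isReps (word (index i) (isIndex i)) (word∈Ω (index i) (isIndex i))
      in trans (unique i (reps~word i (index i) (isIndex i) (hasIndex i)))
          (sym (unique j (reps~word j (index i) (isIndex i) (subst (HasIndex (reps j)) (sym eq) (hasIndex j)))))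

    -- The representative of the double coset of the word for `J` has `J` as an index besides its
    -- own, and a matrix has only one.
    index-surjective : ∀ {J} → IsIndex J → ∃ λ i → J ≡ index i
    index-surjective {J} valid =
      let i , rep~word , _ = proj₂ isReps (word J valid) (word∈Ω J valid)
          _ , _ , e₃₁ , e₁₂ = reps∈Ω i
      in i , index-unique (reps i) e₃₁ e₁₂ J (index i) valid (isIndex i)
               (sameDoubleCoset⇒hasIndex J valid (reps i) (reps∈Ω i) rep~word) (hasIndex i)

    indices-↭ : map index (allFin k) ↭ indices
    indices-↭ = ∼bag⇒↭ (unique∧set⇒bag (Unique.map⁺ index-injective (Unique.allFin⁺ k)) indices-unique (mk⇔ to from))
      where
      to : ∀ {J} → J ∈ map index (allFin k) → J ∈ indices
      to J∈ = let i , _ , J≡ = ∈-map⁻ index J∈ in subst (_∈ indices) (sym J≡) (∈-indices⁺ (isIndex i))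
      from : ∀ {J} → J ∈ indices → J ∈ map index (allFin k)
      from J∈ = let i , J≡ = index-surjective (∈-indices⁻ J∈)
                in subst (_∈ map index (allFin k)) (sym J≡) (∈-map⁺ index (∈-allFin i))

    phase-reps : ∀ i → phase (reps i) ≈ Φ (index i)
    phase-reps i =
      let _ , _ , e₃₁ , e₁₂ = reps∈Ω i
      in ≈-trans (≈-sym (phase-invariant (reps i) (word (index i) (isIndex i)) (d₁ * + f) (d₂ * + f)
                   {{ℤₚ.i*j≢0 d₁ (+ f)}} {{ℤₚ.i*j≢0 d₂ (+ f)}} e₃₁ e₁₂ (reps~word i (index i) (isIndex i) (hasIndex i))))
                 (phase-word (index i) (isIndex i))

    FineKl≈RHS : FineKl m₁ m₂ n₁ n₂ k reps ≈ RHS m₁ m₂ n₁ n₂ d₁ d₂ f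
    FineKl≈RHS = begin
      sumFin k (λ i → phase (reps i))           ≈⟨ sumFin≈sumL k (λ i → i) (λ i → phase (reps i)) ⟩
      sumL (allFin k) (λ i → phase (reps i))    ≈⟨ sumL-cong (allFin k) (λ {i} _ → phase-reps i) ⟩
      sumL (allFin k) (λ i → Φ (index i))       ≡⟨ sumL-map index (allFin k) Φ ⟨
      sumL (map index (allFin k)) Φ             ≈⟨ sumL-↭ Φ indices-↭ ⟩
      sumL indices Φ                            ≈⟨ sum-indices ⟩
      RHS m₁ m₂ n₁ n₂ d₁ d₂ f                   ∎

theorem5p10 : {c ℓ : Level} (R : CommutativeRing c ℓ) → IsDomain R →
    (e : ℚ → CommutativeRing.Carrier R) → IsStdChar R e →
    (d₁ d₂ : ℤ) → d₁ ≢ 0ℤ → d₂ ≢ 0ℤ → (f : ℕ) → .{{_ : NonZero f}} →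
    (m₁ m₂ n₁ n₂ : ℤ) →
    (k : ℕ) (reps : Fin k → Mat3) → IsDoubleCosetReps d₁ d₂ f k reps →
    (¬ (gcd (∣ m₂ * d₂ ∣) f ≡ gcd (∣ n₂ * d₁ ∣) f) →
    CommutativeRing._≈_ R (WithChar.FineKl R e m₁ m₂ n₁ n₂ k reps) (CommutativeRing.0# R))
    × (gcd (∣ m₂ * d₂ ∣) f ≡ gcd (∣ n₂ * d₁ ∣) f →
    CommutativeRing._≈_ R (WithChar.FineKl R e m₁ m₂ n₁ n₂ k reps) (WithChar.RHS R e m₁ m₂ n₁ n₂ d₁ d₂ f))
theorem5p10 R domain e e-char d₁ d₂ d₁≢0 d₂≢0 f m₁ m₂ n₁ n₂ k reps isReps =
  (λ gcd≢ → CommutativeRing.trans R fine≈RHS (RHS≈0 gcd≢)) , (λ _ → fine≈RHS)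
  where
  instance
    d₁-nonZero = ≢-nonZero d₁≢0
    d₂-nonZero = ≢-nonZero d₂≢0
  open Evaluation R domain e e-char d₁ d₂ f m₁ m₂ n₁ n₂
  existence = λ i → DoubleCosets.index-exists d₁ d₂ f (reps i) (proj₁ isReps i)
  fine≈RHS = Reindexing.FineKl≈RHS k reps isReps
    (λ i → proj₁ (existence i)) (λ i → proj₁ (proj₂ (existence i))) (λ i → proj₂ (proj₂ (existence i)))
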